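{- For every integer $n\ge 5$, up to isomorphism, \[\operatorname{obs}(C_n)=C(n-2)\cup LF(n-1)\cup O(n-1),\] where for a positive integer $k$: $C(k)=\{C_m: m=3\text{ or }5\le m\le k+1\}$; $O(k)=\varnothing$ if $k\le 4$, $O(5)=\{B\}$, $O(6)=\{A,B\}$, and $O(k)=\{A,B,E\}$ if $k\ge 7$; $LF(k)=LF_1(k)\cup LF_2(k)\cup LF_3(k)$ with (all $m_2,m_4,m_6$ ranging over non-negative integers) $LF_1(k)=\{m_2K_2: 3m_2=k+2\}$, $LF_2(k)=\{K_1+m_2K_2+m_4P_4: 3m_2+5m_4=k+1\}$, $LF_3(k)=\{K_1+m_2K_2+m_4P_4+m_6P_6: 3m_2+5m_4+7m_6=k\}$.
   Context: All graphs are finite, simple and loopless. $P_n$ and $C_n$ denote the path and cycle on $n$ vertices; $K_1$, $K_2$ are the complete graphs on one and two vertices; $+$ denotes disjoint union and $mG$ the disjoint union of $m$ copies of $G$. A full-homomorphism $\varphi\colon G\to H$ is a map $V(G)\to V(H)$ such that for all $x,y\in V(G)$, $xy\in E(G)$ if and only if $\varphi(x)\varphi(y)\in E(H)$. A full $H$-colouring of $G$ is a full-homomorphism $G\to H$. A minimal $H$-obstruction is a graph $G$ that admits no full $H$-colouring while every proper induced subgraph of $G$ admits one; $\operatorname{obs}(H)$ denotes the set of minimal $H$-obstructions (up to isomorphism). The graphs $A$, $B$, $E$ have vertex set $\{v_0,\dots,v_5\}$ and edge sets: $E(A)=\{v_0v_1,v_1v_2,v_2v_3,v_3v_4,v_4v_5,v_1v_4\}$;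 $E(B)=E(A)\cup\{v_0v_5\}$; $E(E)=\{v_0v_1,v_1v_2,v_0v_5,v_1v_4,v_2v_3\}$. -}

module Defs where

open import Data.Fin using (Fin; toℕ; splitAt)
open import Data.Fin.Patterns using (0F; 1F; 2F; 3F; 4F; 5F)
import Data.Fin.Properties as Fin
open import Data.List using (List; []; _∷_; _++_)
import Data.List.Membership.DecPropositional as ListMembership
open import Data.Nat using (ℕ; zero; suc; _+_; _*_; _≤_; _<_)
import Data.Nat.Properties as ℕ
open import Data.Product using (Σ-syntax; _×_; _,_)
import Data.Product.Properties as Product
open import Data.Sum using (_⊎_; swap)
open import Data.Sum.Relation.Binary.Pointwise as Pointwise using (Pointwise)
open import Data.Unit using (⊤; tt)
open import Function using (_on_; _⇔_; _↔_; _↣_; Inverse; Injection)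
open import Level using (0ℓ)
open import Relation.Binary using (Rel; Decidable; Symmetric; Irreflexive)
open import Relation.Binary.PropositionalEquality using (_≡_; _≢_; ≢-sym; cong)
open import Relation.Nullary using (¬_; yes)
open import Relation.Nullary.Decidable using (_×-dec_; _⊎-dec_; ¬?)
open import Relation.Unary using (Pred; _∪_)

-- Finite simple graphs, with vertex set normalised to Fin order.
record Graph : Set₁ where
  infix 4 _~_ _~?_
  field
    order  : ℕ
    _~_    : Rel (Fin order) 0ℓ
    _~?_   : Decidable _~_
    symm   : Symmetric _~_
    irrefl : Irreflexive _≡_ _~_

  Vertex : Set
  Vertex = Fin order

open Graph public using (order; Vertex)

infix 4 _≅_
_≅_ : Graph → Graph → Set
G ≅ H = Σ[ f ∈ Vertex G ↔ Vertex H ]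
        (∀ x y → x G.~ y ⇔ Inverse.to f x H.~ Inverse.to f y)
  where module G = Graph G
        module H = Graph H

IsFullHom : (G H : Graph) → (Vertex G → Vertex H) → Set
IsFullHom G H φ = ∀ x y → x G.~ y ⇔ φ x H.~ φ y
  where module G = Graph G
        module H = Graph H

-- FullColouring H G : G admits a full H-colouring.
FullColouring : (H G : Graph) → Set
FullColouring H G = Σ[ φ ∈ (Vertex G → Vertex H) ] IsFullHom G H φ

-- The subgraph of G induced by the image of f, whose vertices are listed
-- without repetition by f.
induced : (G : Graph) {m : ℕ} → Fin m ↣ Vertex G → Graph
induced G {m} f = record
  { order  = m
  ; _~_    = G._~_ on Injection.to f
  ; _~?_   = λ x y → Injection.to f x G.~? Injection.to f y
  ; symm   = G.symm
  ; irrefl = λ x≡y → G.irrefl (cong (Injection.to f) x≡y)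
  }
  where module G = Graph G

-- All minimal H-obstructions; this class is closed under isomorphism.
-- An induced subgraph of G is proper iff it has fewer vertices than G.
obs : Graph → Pred Graph 0ℓ
obs H G = ¬ FullColouring H G
        × (∀ {m} → m < order G → (f : Fin m ↣ Vertex G) →
           FullColouring H (induced G f))

UpToIso : Pred Graph 0ℓ → Pred Graph _
UpToIso 𝓕 G = Σ[ F ∈ Graph ] (𝓕 F × G ≅ F)

-- The simple graph on Fin n obtained from a set of arcs by forgetting
-- orientations and discarding loops.
fromArcs : (n : ℕ) (R : Rel (Fin n) 0ℓ) → Decidable R → Graph
fromArcs n R R? = record
  { order  = n
  ; _~_    = λ x y → x ≢ y × (R x y ⊎ R y x)
  ; _~?_   = λ x y → ¬? (x Fin.≟ y) ×-dec (R? x y ⊎-dec R? y x)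
  ; symm   = λ (x≢y , r) → ≢-sym x≢y , swap r
  ; irrefl = λ x≡y (x≢y , _) → x≢y x≡y
  }

K : ℕ → Graph
K n = fromArcs n (λ _ _ → ⊤) (λ _ _ → yes tt)

P : ℕ → Graph
P n = fromArcs n (λ x y → toℕ y ≡ suc (toℕ x))
                 (λ x y → toℕ y ℕ.≟ suc (toℕ x))

-- This is the n-cycle only for n ≥ 3.
C : ℕ → Graph
C n = fromArcs n
  (λ x y → toℕ y ≡ suc (toℕ x) ⊎ (suc (toℕ x) ≡ n × toℕ y ≡ 0))
  (λ x y → (toℕ y ℕ.≟ suc (toℕ x)) ⊎-dec
           ((suc (toℕ x) ℕ.≟ n) ×-dec (toℕ y ℕ.≟ 0)))

fromEdges : (n : ℕ) → List (Fin n × Fin n) → Graph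
fromEdges n es = fromArcs n (λ x y → (x , y) ∈ es) (λ x y → (x , y) ∈? es)
  where open ListMembership (Product.≡-dec (Fin._≟_ {n}) (Fin._≟_ {n}))
             using (_∈_; _∈?_)

edgesA edgesB edgesE : List (Fin 6 × Fin 6)
edgesA = (0F , 1F) ∷ (1F , 2F) ∷ (2F , 3F) ∷ (3F , 4F) ∷ (4F , 5F) ∷ (1F , 4F) ∷ []
edgesB = edgesA ++ (0F , 5F) ∷ []
edgesE = (0F , 1F) ∷ (1F , 2F) ∷ (0F , 5F) ∷ (1F , 4F) ∷ (2F , 3F) ∷ []

A B E : Graph
A = fromEdges 6 edgesA
B = fromEdges 6 edgesB
E = fromEdges 6 edgesE

infixl 6 _⊕_
infixr 7 _·_

-- Disjoint union.
_⊕_ : Graph → Graph → Graph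
G ⊕ H = record
  { order  = order G + order H
  ; _~_    = Pointwise G._~_ H._~_ on splitAt (order G)
  ; _~?_   = λ x y → Pointwise.⊎-decidable G._~?_ H._~?_
                       (splitAt (order G) x) (splitAt (order G) y)
  ; symm   = Pointwise.⊎-symmetric G.symm H.symm
  ; irrefl = λ x≡y → Pointwise.⊎-irreflexive G.irrefl H.irrefl
                       (Pointwise.≡⇒Pointwise-≡ (cong (splitAt (order G)) x≡y))
  }
  where module G = Graph G
        module H = Graph H

-- m · G is the disjoint union of m copies of G; 0 · G is the empty graph.
_·_ : ℕ → Graph → Graph
zero  · G = K 0
suc m · G = G ⊕ m · G

data CycleFamily (k : ℕ) : Pred Graph 0ℓ where
  triangle : CycleFamily k (C 3)
  cycle    : ∀ m → 5 ≤ m → m ≤ k + 1 → CycleFamily k (C m)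

data LF₁ (k : ℕ) : Pred Graph 0ℓ where
  lf₁ : ∀ m₂ → 3 * m₂ ≡ k + 2 → LF₁ k (m₂ · K 2)

data LF₂ (k : ℕ) : Pred Graph 0ℓ where
  lf₂ : ∀ m₂ m₄ → 3 * m₂ + 5 * m₄ ≡ k + 1 →
        LF₂ k (K 1 ⊕ m₂ · K 2 ⊕ m₄ · P 4)

data LF₃ (k : ℕ) : Pred Graph 0ℓ where
  lf₃ : ∀ m₂ m₄ m₆ → 3 * m₂ + 5 * m₄ + 7 * m₆ ≡ k →
        LF₃ k (K 1 ⊕ m₂ · K 2 ⊕ m₄ · P 4 ⊕ m₆ · P 6)

LF : ℕ → Pred Graph 0ℓ
LF k = LF₁ k ∪ LF₂ k ∪ LF₃ k

data O (k : ℕ) : Pred Graph 0ℓ where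
  B∈O : 5 ≤ k → O k B
  A∈O : 6 ≤ k → O k A
  E∈O : 7 ≤ k → O k E

{-# OPTIONS --safe #-}
module Submission where

-- A point-determining graph is fully C n-colourable iff it is an induced subgraph
-- of C n, and minimal obstructions are point-determining.  A disjoint union of
-- paths with l₁, …, l_r vertices embeds in C n iff its weight Σ (lᵢ + 1) is at
-- most n: besides the images of the vertices, the successors of the r right ends
-- are r further vertices of C n.
--
-- Conversely let G be a minimal obstruction.  A triangle gives C 3; a 4-cycle
-- extends to A or B, because its opposite vertices are not twins; then a vertex of
-- degree three extends to E or to a 5-cycle.  Otherwise G has maximum degree two.
-- A cycle C m in G is listed if m < n, while m = n leaves K₁ + P (n - 1) and m > n
-- leaves P n as a proper noncolourable subgraph; so G is a disjoint union of paths.  Deleting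
-- a vertex of P l gives P 1 + P (l - 2) or P 2 + P (l - 3), which has the same
-- weight as P l.  Minimality therefore allows no component that stays
-- point-determining under such a deletion, which leaves K₂ or, in the presence
-- of K₁, the orders 2, 4 and 6, with weight n + 1 or n + 2.

open import Defs
import Data.Bool.Properties as Bool
open import Data.Bool using (if_then_else_)
open import Data.Empty using (⊥; ⊥-elim)
open import Data.Fin using (Fin; Fin′; zero; suc; toℕ; fromℕ; fromℕ<; inject; inject₁; inject≤; splitAt; join; punchOut; _↑ˡ_; _↑ʳ_)
open import Data.Fin.Patterns using (0F; 1F; 2F; 3F; 4F; 5F)
import Data.Fin.Properties as Fin
open import Data.List using (List; []; _∷_; _++_)
open import Data.List.Membership.Propositional.Properties using (∈-∃++)
open import Data.List.Relation.Binary.Permutation.Propositional as ↭ using (_↭_; ↭-sym)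
open import Data.List.Relation.Binary.Permutation.Propositional.Properties as ↭ using (All-resp-↭)
open import Data.List.Relation.Unary.All as All using (All; []; _∷_)
open import Data.List.Relation.Unary.Any using (here; there)
open import Data.Nat using (ℕ; zero; suc; _+_; _*_; _∸_; _≤_; _<_; z≤n; s≤s; z<s; s<s)
import Data.Nat.Properties as ℕ
open import Data.List.Membership.DecPropositional ℕ._≟_ using (_∈_; _∉_; _∈?_)
open import Data.Nat.Tactic.RingSolver using (solve-∀)
open import Data.Product using (Σ-syntax; ∃; ∃-syntax; _×_; _,_; proj₁; proj₂)
open import Data.Sum as Sum using (_⊎_; inj₁; inj₂; [_,_]′)
import Data.Sum.Properties as Sum
open import Data.Sum.Relation.Binary.Pointwise using (Pointwise; inj₁; inj₂)
open import Data.Unit using (⊤; tt)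
open import Data.Vec using (Vec; []; _∷_; lookup)
open import Function using (_∘_; id; case_of_; _⇔_; mk⇔; _↣_; mk↣; mk↔ₛ′; Equivalence; Inverse; Injection; Injective)
import Function.Properties.Equivalence as ⇔
open import Level using (0ℓ)
open import Relation.Binary using (Rel; Decidable; tri<; tri≈; tri>)
open import Relation.Binary.PropositionalEquality using (_≡_; _≢_; refl; sym; trans; cong; cong₂; subst; subst₂)
open import Relation.Nullary using (¬_; Dec; yes; no; does; contradiction)
open import Relation.Nullary.Decidable using (_×-dec_; _⊎-dec_; _→-dec_; ¬?; from-yes; map′)
open import Relation.Unary using (Pred; _∪_; _≐_)

-- The weight is tested from two sides. Noncolourability counts vertices of `C n`, which needs
-- injectivity and hence point-determination. Colourability after a deletion may identify twins, and
-- only this makes the listed forests minimal: the two ends of a `P 3` take one place, and any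
-- number of isolated vertices together cost the 2 units of a single one. So in the presence of
-- `K 1`, deleting any vertex of `K 2`, `P 4` or `P 6` saves at least 3, 2 or 1 units. A forest of
-- weight n + 2 must save 2, which rules out `P 6` and gives `LF₂`; one of weight n + 1 must save 1,
-- which gives `LF₃`. Without `K 1`, a deletion in `K 2` saves 3 units but its other vertex becomes
-- isolated and costs 2; the net saving of 1 is the weight n + 1 of `LF₁`.

infix 4 _↪_ _⊑_

-- Stated for relations on arbitrary types, so that disjoint unions can be treated on `X ⊎ Y`, by
-- constructors, and carried to `Fin` only at the end, along `split-↪` and `join-↪`.
record _↪_ {A B : Set} (R : Rel A 0ℓ) (S : Rel B 0ℓ) : Set where
  field
    to        : A → B
    injective : Injective _≡_ _≡_ to
    full      : ∀ x y → R x y ⇔ S (to x) (to y)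

open _↪_

↪-refl : {A : Set} {R : Rel A 0ℓ} → R ↪ R
↪-refl = record { to = id ; injective = id ; full = λ _ _ → ⇔.refl }

↪-trans : {A B C : Set} {R : Rel A 0ℓ} {S : Rel B 0ℓ} {T : Rel C 0ℓ} →
          R ↪ S → S ↪ T → R ↪ T
↪-trans f g = record
  { to        = to g ∘ to f
  ; injective = injective f ∘ injective g
  ; full      = λ x y → ⇔.trans (full f x y) (full g (to f x) (to f y))
  }

record _⊑_ (F G : Graph) : Set where
  constructor emb
  field rel : Graph._~_ F ↪ Graph._~_ G

open _⊑_

⊑-refl : ∀ {G} → G ⊑ G
⊑-refl = emb ↪-refl

⊑-trans : ∀ {F G H} → F ⊑ G → G ⊑ H → F ⊑ H
⊑-trans (emb f) (emb g) = emb (↪-trans f g)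

⊑⇒≤ : ∀ {F G} → F ⊑ G → order F ≤ order G
⊑⇒≤ (emb f) = Fin.injective⇒≤ (injective f)

colour-⊑ : ∀ H {F G} → F ⊑ G → FullColouring H G → FullColouring H F
colour-⊑ H (emb f) (φ , hom) =
  φ ∘ to f , λ x y → ⇔.trans (full f x y) (hom (to f x) (to f y))

private
  variable
    X X′ Y Y′ Z : Set

-- Embeddings between disjoint unions.

module _ {R : Rel X 0ℓ} {R′ : Rel X′ 0ℓ} {S : Rel Y 0ℓ} {S′ : Rel Y′ 0ℓ} where

  map-↪ : R ↪ R′ → S ↪ S′ → Pointwise R S ↪ Pointwise R′ S′
  map-↪ f g = record { to = Sum.map (to f) (to g) ; injective = inj ; full = hom }
    where
    inj : Injective _≡_ _≡_ (Sum.map (to f) (to g))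
    inj {inj₁ _} {inj₁ _} eq = cong inj₁ (injective f (Sum.inj₁-injective eq))
    inj {inj₂ _} {inj₂ _} eq = cong inj₂ (injective g (Sum.inj₂-injective eq))

    hom : ∀ x y → Pointwise R S x y ⇔
                  Pointwise R′ S′ (Sum.map (to f) (to g) x) (Sum.map (to f) (to g) y)
    hom (inj₁ x) (inj₁ y) = mk⇔
      (λ { (inj₁ r) → inj₁ (Equivalence.to (full f x y) r) })
      (λ { (inj₁ r) → inj₁ (Equivalence.from (full f x y) r) })
    hom (inj₁ x) (inj₂ y) = mk⇔ (λ ()) (λ ())
    hom (inj₂ x) (inj₁ y) = mk⇔ (λ ()) (λ ())
    hom (inj₂ x) (inj₂ y) = mk⇔
      (λ { (inj₂ s) → inj₂ (Equivalence.to (full g x y) s) })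
      (λ { (inj₂ s) → inj₂ (Equivalence.from (full g x y) s) })

module _ {R : Rel X 0ℓ} {S : Rel Y 0ℓ} where

  swap-↪ : Pointwise R S ↪ Pointwise S R
  swap-↪ = record
    { to        = Sum.swap
    ; injective = λ {x} {y} eq →
        trans (sym (Sum.swap-involutive x)) (trans (cong Sum.swap eq) (Sum.swap-involutive y))
    ; full      = λ where
        (inj₁ _) (inj₁ _) → mk⇔ (λ { (inj₁ r) → inj₂ r }) (λ { (inj₂ r) → inj₁ r })
        (inj₁ _) (inj₂ _) → mk⇔ (λ ()) (λ ())
        (inj₂ _) (inj₁ _) → mk⇔ (λ ()) (λ ())
        (inj₂ _) (inj₂ _) → mk⇔ (λ { (inj₂ r) → inj₁ r }) (λ { (inj₁ r) → inj₂ r })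
    }

module _ {Q : Rel X 0ℓ} {R : Rel Y 0ℓ} {S : Rel Z 0ℓ} where

  assocˡ-↪ : Pointwise Q (Pointwise R S) ↪ Pointwise (Pointwise Q R) S
  assocˡ-↪ = record { to = Sum.assocˡ ; injective = inj ; full = hom }
    where
    assocʳ∘assocˡ : (x : X ⊎ (Y ⊎ Z)) → Sum.assocʳ (Sum.assocˡ x) ≡ x
    assocʳ∘assocˡ (inj₁ _)        = refl
    assocʳ∘assocˡ (inj₂ (inj₁ _)) = refl
    assocʳ∘assocˡ (inj₂ (inj₂ _)) = refl

    inj : Injective _≡_ _≡_ Sum.assocˡ
    inj {x} {y} eq =
      trans (sym (assocʳ∘assocˡ x)) (trans (cong Sum.assocʳ eq) (assocʳ∘assocˡ y))

    hom : ∀ x y → Pointwise Q (Pointwise R S) x y ⇔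
                  Pointwise (Pointwise Q R) S (Sum.assocˡ x) (Sum.assocˡ y)
    hom (inj₁ _)        (inj₁ _)        = mk⇔ (λ { (inj₁ q) → inj₁ (inj₁ q) }) (λ { (inj₁ (inj₁ q)) → inj₁ q })
    hom (inj₁ _)        (inj₂ (inj₁ _)) = mk⇔ (λ ()) (λ { (inj₁ ()) })
    hom (inj₁ _)        (inj₂ (inj₂ _)) = mk⇔ (λ ()) (λ ())
    hom (inj₂ (inj₁ _)) (inj₁ _)        = mk⇔ (λ ()) (λ { (inj₁ ()) })
    hom (inj₂ (inj₁ _)) (inj₂ (inj₁ _)) = mk⇔ (λ { (inj₂ (inj₁ r)) → inj₁ (inj₂ r) }) (λ { (inj₁ (inj₂ r)) → inj₂ (inj₁ r) })
    hom (inj₂ (inj₁ _)) (inj₂ (inj₂ _)) = mk⇔ (λ { (inj₂ ()) }) (λ ())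
    hom (inj₂ (inj₂ _)) (inj₁ _)        = mk⇔ (λ ()) (λ ())
    hom (inj₂ (inj₂ _)) (inj₂ (inj₁ _)) = mk⇔ (λ { (inj₂ ()) }) (λ ())
    hom (inj₂ (inj₂ _)) (inj₂ (inj₂ _)) = mk⇔ (λ { (inj₂ (inj₂ s)) → inj₂ s }) (λ { (inj₂ s) → inj₂ (inj₂ s) })

splitAt-injective : ∀ m {n} → Injective _≡_ _≡_ (splitAt m {n})
splitAt-injective m {n} {x} {y} eq =
  trans (sym (Fin.join-splitAt m n x)) (trans (cong (join m n) eq) (Fin.join-splitAt m n y))

join-injective : ∀ m n → Injective _≡_ _≡_ (join m n)
join-injective m n {x} {y} eq =
  trans (sym (Fin.splitAt-join m n x)) (trans (cong (splitAt m) eq) (Fin.splitAt-join m n y))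

module _ (F G : Graph) where

  private
    module F = Graph F
    module G = Graph G

  split-↪ : Graph._~_ (F ⊕ G) ↪ Pointwise F._~_ G._~_
  split-↪ = record
    { to = splitAt (order F) ; injective = splitAt-injective (order F) ; full = λ _ _ → ⇔.refl }

  join-↪ : Pointwise F._~_ G._~_ ↪ Graph._~_ (F ⊕ G)
  join-↪ = record
    { to        = join (order F) (order G)
    ; injective = join-injective (order F) (order G)
    ; full      = λ x y → subst₂ (λ s t → Pointwise F._~_ G._~_ x y ⇔ Pointwise F._~_ G._~_ s t)
                            (sym (Fin.splitAt-join (order F) (order G) x))
                            (sym (Fin.splitAt-join (order F) (order G) y))
                            ⇔.refl
    }

⊕-mono : ∀ {F F′ G G′} → F ⊑ F′ → G ⊑ G′ → F ⊕ G ⊑ F′ ⊕ G′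
⊕-mono {F} {F′} {G} {G′} (emb f) (emb g) =
  emb (↪-trans (split-↪ F G) (↪-trans (map-↪ f g) (join-↪ F′ G′)))

⊕-comm : ∀ F G → F ⊕ G ⊑ G ⊕ F
⊕-comm F G = emb (↪-trans (split-↪ F G) (↪-trans swap-↪ (join-↪ G F)))

⊕-assocˡ : ∀ F G H → F ⊕ (G ⊕ H) ⊑ F ⊕ G ⊕ H
⊕-assocˡ F G H = emb
  (↪-trans (split-↪ F (G ⊕ H)) (↪-trans (map-↪ ↪-refl (split-↪ G H)) (↪-trans assocˡ-↪
  (↪-trans (map-↪ (join-↪ F G) ↪-refl) (join-↪ (F ⊕ G) H)))))

⊕-assocʳ : ∀ F G H → F ⊕ G ⊕ H ⊑ F ⊕ (G ⊕ H)
⊕-assocʳ F G H =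
  ⊑-trans (⊕-comm (F ⊕ G) H) (⊑-trans (⊕-assocˡ H F G) (⊑-trans (⊕-comm (H ⊕ F) G)
  (⊑-trans (⊕-assocˡ G H F) (⊕-comm (G ⊕ H) F))))

⊕-exchange : ∀ F G H → F ⊕ (G ⊕ H) ⊑ G ⊕ (F ⊕ H)
⊕-exchange F G H =
  ⊑-trans (⊕-assocˡ F G H) (⊑-trans (⊕-mono (⊕-comm F G) (⊑-refl {H})) (⊕-assocʳ G F H))

⊑-⊕ˡ : ∀ F G → F ⊑ F ⊕ G
⊑-⊕ˡ F G = emb (↪-trans inj₁-↪ (join-↪ F G))
  where
  inj₁-↪ : Graph._~_ F ↪ Pointwise (Graph._~_ F) (Graph._~_ G)
  inj₁-↪ = record
    { to = inj₁ ; injective = Sum.inj₁-injective ; full = λ _ _ → mk⇔ inj₁ (λ { (inj₁ r) → r }) }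

⊑-⊕ʳ : ∀ F G → G ⊑ F ⊕ G
⊑-⊕ʳ F G = emb (↪-trans inj₂-↪ (join-↪ F G))
  where
  inj₂-↪ : Graph._~_ G ↪ Pointwise (Graph._~_ F) (Graph._~_ G)
  inj₂-↪ = record
    { to = inj₂ ; injective = Sum.inj₂-injective ; full = λ _ _ → mk⇔ inj₂ (λ { (inj₂ r) → r }) }

⊕-universal : ∀ {F G H} (f : F ⊑ H) (g : G ⊑ H) →
              (∀ x y → to (rel f) x ≢ to (rel g) y) →
              (∀ x y → ¬ Graph._~_ H (to (rel f) x) (to (rel g) y)) →
              F ⊕ G ⊑ H
⊕-universal {F} {G} {H} (emb f) (emb g) f≢g f≁g = emb (↪-trans (split-↪ F G) (record
  { to = [ to f , to g ]′ ; injective = inj ; full = hom }))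
  where
  module H = Graph H

  inj : Injective _≡_ _≡_ [ to f , to g ]′
  inj {inj₁ _} {inj₁ _} eq = cong inj₁ (injective f eq)
  inj {inj₁ x} {inj₂ y} eq = contradiction eq (f≢g x y)
  inj {inj₂ x} {inj₁ y} eq = contradiction (sym eq) (f≢g y x)
  inj {inj₂ _} {inj₂ _} eq = cong inj₂ (injective g eq)

  hom : ∀ x y → Pointwise (Graph._~_ F) (Graph._~_ G) x y ⇔
                ([ to f , to g ]′ x H.~ [ to f , to g ]′ y)
  hom (inj₁ x) (inj₁ y) = ⇔.trans (mk⇔ (λ { (inj₁ r) → r }) inj₁) (full f x y)
  hom (inj₁ x) (inj₂ y) = mk⇔ (λ ()) (λ r → contradiction r (f≁g x y))
  hom (inj₂ x) (inj₁ y) = mk⇔ (λ ()) (λ r → contradiction (H.symm r) (f≁g y x))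
  hom (inj₂ x) (inj₂ y) = ⇔.trans (mk⇔ (λ { (inj₂ r) → r }) inj₂) (full g x y)

-- Counting vertices, and isomorphism from embeddings.

Surjective : {A B : Set} → (A → B) → Set
Surjective f = ∀ y → ∃[ x ] f x ≡ y

surjective? : ∀ {m n} (f : Fin m → Fin n) → Surjective f ⊎ ∃[ y ] ∀ x → f x ≢ y
surjective? f with Fin.all? (λ y → Fin.any? (λ x → f x Fin.≟ y))
... | yes sur = inj₁ sur
... | no ¬sur with Fin.¬∀⟶∃¬ _ _ (λ y → Fin.any? (λ x → f x Fin.≟ y)) ¬sur
...   | y , y∉f = inj₂ (y , λ x eq → y∉f (x , eq))

missed⇒< : ∀ {m n} {f : Fin m → Fin n} → Injective _≡_ _≡_ f →
           (y : Fin n) → (∀ x → f x ≢ y) → m < n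
missed⇒< {m} {n} {f} inj y y∉f = Fin.injective⇒≤ {f = g} g-inj
  where
  g : Fin (suc m) → Fin n
  g zero    = y
  g (suc x) = f x

  g-inj : Injective _≡_ _≡_ g
  g-inj {zero}  {zero}  _  = refl
  g-inj {zero}  {suc x} eq = contradiction (sym eq) (y∉f x)
  g-inj {suc x} {zero}  eq = contradiction eq (y∉f x)
  g-inj {suc _} {suc _} eq = cong suc (inj eq)

surjective⇒≤ : ∀ {m n} {f : Fin m → Fin n} → Surjective f → n ≤ m
surjective⇒≤ {f = f} sur = Fin.injective⇒≤ {f = proj₁ ∘ sur} λ {x} {y} eq →
  trans (sym (proj₂ (sur x))) (trans (cong f eq) (proj₂ (sur y)))

⊑-surjective⇒≅ : ∀ {F G} (f : F ⊑ G) → Surjective (to (rel f)) → G ≅ F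
⊑-surjective⇒≅ {F} {G} (emb f) sur =
  mk↔ₛ′ g (to f) (λ x → injective f (fg (to f x))) fg ,
  λ x y → ⇔.sym (subst₂ (λ s t → g x F.~ g y ⇔ s G.~ t) (fg x) (fg y) (full f (g x) (g y)))
  where
  module F = Graph F
  module G = Graph G
  g  = proj₁ ∘ sur
  fg = proj₂ ∘ sur

⊑⇒≅ : ∀ {F G} → F ⊑ G → order G ≤ order F → G ≅ F
⊑⇒≅ f G≤F with surjective? (to (rel f))
... | inj₁ sur       = ⊑-surjective⇒≅ f sur
... | inj₂ (y , y∉f) = contradiction (missed⇒< (injective (rel f)) y y∉f) (ℕ.≤⇒≯ G≤F)

≅-sym : ∀ G H → G ≅ H → H ≅ G
≅-sym G H (f , hom) =
  mk↔ₛ′ (Inverse.from f) (Inverse.to f) (Inverse.strictlyInverseʳ f) (Inverse.strictlyInverseˡ f) ,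
  λ x y → ⇔.sym (subst₂ (λ s t → Inverse.from f x G.~ Inverse.from f y ⇔ s H.~ t)
    (Inverse.strictlyInverseˡ f x) (Inverse.strictlyInverseˡ f y) (hom _ _))
  where
  module G = Graph G
  module H = Graph H

≅⇒⊑ : ∀ G H → G ≅ H → G ⊑ H
≅⇒⊑ G H (f , hom) = emb (record { to = Inverse.to f ; injective = inj ; full = hom })
  where
  inj : Injective _≡_ _≡_ (Inverse.to f)
  inj {x} {y} eq = trans (sym (Inverse.strictlyInverseʳ f x))
    (trans (cong (Inverse.from f) eq) (Inverse.strictlyInverseʳ f y))

-- Minimal obstructions.

sub : ∀ {F G} (f : F ⊑ G) → Vertex F ↣ Vertex G
sub (emb f) = mk↣ (injective f)

proper-colour : ∀ H {F G} → obs H G → F ⊑ G → order F < order G → FullColouring H F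
proper-colour H (_ , small) f F<G with small F<G (sub f)
... | φ , hom = φ , λ x y → ⇔.trans (full (rel f) x y) (hom x y)

-- A noncolourable induced subgraph of a minimal obstruction cannot be proper. To classify an
-- obstruction it is therefore enough to find a listed graph inside it.
obs⇒≅ : ∀ H {F G} → obs H G → F ⊑ G → ¬ FullColouring H F → G ≅ F
obs⇒≅ H G∈obs f ¬col = ⊑⇒≅ f (ℕ.≮⇒≥ (¬col ∘ proper-colour H G∈obs f))

obs-≅ : ∀ H F G → G ≅ F → obs H F → obs H G
obs-≅ H F G G≅F F∈obs@(¬col , _) =
  ¬col ∘ colour-⊑ H (≅⇒⊑ F G (≅-sym G F G≅F)) ,
  λ m<G f → proper-colour H F∈obs (⊑-trans (induced-⊑ f) (≅⇒⊑ G F G≅F))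
              (ℕ.<-≤-trans m<G (⊑⇒≤ (≅⇒⊑ G F G≅F)))
  where
  induced-⊑ : ∀ {m} (f : Fin m ↣ Vertex G) → induced G f ⊑ G
  induced-⊑ f = emb (record
    { to = Injection.to f ; injective = Injection.injective f ; full = λ _ _ → ⇔.refl })

-- The map is total and only its values on `U` matter, so deleting a vertex requires no renumbering
-- of `Fin`.
ColourOn : (H G : Graph) → Pred (Vertex G) 0ℓ → Set
ColourOn H G U = Σ[ φ ∈ (Vertex G → Vertex H) ]
                 (∀ x y → U x → U y → Graph._~_ G x y ⇔ Graph._~_ H (φ x) (φ y))

-- A proper induced subgraph misses some vertex `v`, and a colouring of the graph without `v`
-- restricts to it.
obs-by-deletion : ∀ H G → ¬ FullColouring H G → (∀ v → ColourOn H G (_≢ v)) → obs H G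
obs-by-deletion H G ¬col del = ¬col , small
  where
  small : ∀ {m} → m < order G → (f : Fin m ↣ Vertex G) → FullColouring H (induced G f)
  small m<G f with surjective? (Injection.to f)
  ... | inj₁ sur       = contradiction (surjective⇒≤ sur) (ℕ.<⇒≱ m<G)
  ... | inj₂ (v , v∉f) with del v
  ...   | φ , hom = φ ∘ Injection.to f , λ x y → hom _ _ (v∉f x) (v∉f y)

-- Point-determining graphs.

PointDetermining : Graph → Set
PointDetermining G = ∀ x y → (∀ z → z ~ x ⇔ z ~ y) → x ≡ y
  where open Graph G

-- Adjacency is read off the images, so vertices with the same image have the same neighbours.
hom-injective : ∀ F G {φ} → PointDetermining F → IsFullHom F G φ → Injective _≡_ _≡_ φ
hom-injective F G {φ} pd hom {x} {y} eq = pd x y λ z →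
  ⇔.trans (subst (λ w → z F.~ x ⇔ φ z G.~ w) eq (hom z x)) (⇔.sym (hom z y))
  where
  module F = Graph F
  module G = Graph G

hom⇒⊑ : ∀ F G {φ} → PointDetermining F → IsFullHom F G φ → F ⊑ G
hom⇒⊑ F G {φ} pd hom = emb (record { to = φ ; injective = hom-injective F G pd hom ; full = hom })

Distinguishes : (G : Graph) → Vertex G → Vertex G → Vertex G → Set
Distinguishes G x y z = (z ~ x × ¬ z ~ y) ⊎ (¬ z ~ x × z ~ y)
  where open Graph G

distinguishes? : ∀ G x y z → Dec (Distinguishes G x y z)
distinguishes? G x y z = ((z ~? x) ×-dec ¬? (z ~? y)) ⊎-dec (¬? (z ~? x) ×-dec (z ~? y))
  where open Graph G

¬distinguishes : ∀ G {x y z} → ¬ Distinguishes G x y z → Graph._~_ G z x ⇔ Graph._~_ G z y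
¬distinguishes G {x} {y} {z} ¬d with Graph._~?_ G z x | Graph._~?_ G z y
... | yes p | yes q = mk⇔ (λ _ → q) (λ _ → p)
... | yes p | no ¬q = contradiction (inj₁ (p , ¬q)) ¬d
... | no ¬p | yes q = contradiction (inj₂ (¬p , q)) ¬d
... | no ¬p | no ¬q = mk⇔ (λ p → contradiction p ¬p) (λ q → contradiction q ¬q)

-- A vertex with a twin can be deleted without changing colourability.
obs-distinguishes : ∀ H G → obs H G → ∀ {x y} → x ≢ y → ∃ (Distinguishes G x y)
obs-distinguishes H G@record { order = suc _ } G∈obs@(¬col , small) {x} {y} x≢y
  with Fin.any? (distinguishes? G x y)
... | yes found = found
... | no ¬found = contradiction (φ′ , hom′) ¬col
  where
  module G = Graph G
  module H = Graph H
  twins : ∀ z → z G.~ x ⇔ z G.~ y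
  twins z = ¬distinguishes G (λ d → ¬found (z , d))

  rest = small ℕ.≤-refl (mk↣ (Fin.punchIn-injective x _ _))

  r : Vertex G → Vertex G
  r z with x Fin.≟ z
  ... | yes _ = y
  ... | no  _ = z

  r≢x : ∀ z → x ≢ r z
  r≢x z with x Fin.≟ z
  ... | yes _  = x≢y
  ... | no x≢z = x≢z

  r-~ : ∀ z w → z G.~ w ⇔ z G.~ r w
  r-~ z w with x Fin.≟ w
  ... | yes refl = twins z
  ... | no _     = ⇔.refl

  flip-~ : ∀ {z w} → z G.~ w ⇔ w G.~ z
  flip-~ = mk⇔ G.symm G.symm

  φ′ : Vertex G → Vertex H
  φ′ z = proj₁ rest (punchOut (r≢x z))

  hom′ : IsFullHom G H φ′
  hom′ z w = ⇔.trans (⇔.trans (r-~ z w) (⇔.trans flip-~ (⇔.trans (r-~ (r w) z) flip-~)))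
    (⇔.trans (subst₂ (λ s t → r z G.~ r w ⇔ s G.~ t)
               (sym (Fin.punchIn-punchOut (r≢x z))) (sym (Fin.punchIn-punchOut (r≢x w))) ⇔.refl)
             (proj₂ rest _ _))

obs⇒PointDetermining : ∀ H G → obs H G → PointDetermining G
obs⇒PointDetermining H G G∈obs x y twins with x Fin.≟ y
... | yes x≡y = x≡y
... | no x≢y with obs-distinguishes H G G∈obs x≢y
...   | z , inj₁ (p , ¬q) = contradiction (Equivalence.to (twins z) p) ¬q
...   | z , inj₂ (¬p , q) = contradiction (Equivalence.from (twins z) q) ¬p

HasNoIsolated : Graph → Set
HasNoIsolated G = ∀ x → ∃[ z ] z ~ x
  where open Graph G

module _ (F G : Graph) where

  private
    module F = Graph F
    module G = Graph G
    module FG = Graph (F ⊕ G)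

    reflect : PointDetermining F → PointDetermining G → HasNoIsolated G → ∀ s t →
      (∀ r → Pointwise F._~_ G._~_ r s ⇔ Pointwise F._~_ G._~_ r t) → s ≡ t
    reflect pdF pdG ni (inj₁ x) (inj₁ y) twins = cong inj₁ (pdF x y λ z → mk⇔
      (λ r → case Equivalence.to (twins (inj₁ z)) (inj₁ r) of λ { (inj₁ r′) → r′ })
      (λ r → case Equivalence.from (twins (inj₁ z)) (inj₁ r) of λ { (inj₁ r′) → r′ }))
    reflect pdF pdG ni (inj₁ x) (inj₂ y) twins with ni y
    ... | z , r with Equivalence.from (twins (inj₂ z)) (inj₂ r)
    ... | ()
    reflect pdF pdG ni (inj₂ x) (inj₁ y) twins with ni x
    ... | z , r with Equivalence.to (twins (inj₂ z)) (inj₂ r)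
    ... | ()
    reflect pdF pdG ni (inj₂ x) (inj₂ y) twins = cong inj₂ (pdG x y λ z → mk⇔
      (λ r → case Equivalence.to (twins (inj₂ z)) (inj₂ r) of λ { (inj₂ r′) → r′ })
      (λ r → case Equivalence.from (twins (inj₂ z)) (inj₂ r) of λ { (inj₂ r′) → r′ }))

  -- Twins in different summands would both be isolated, so it suffices that one summand has no
  -- isolated vertex. Taking the right one lets `K 1` stand first.
  ⊕-pointDetermining : PointDetermining F → PointDetermining G → HasNoIsolated G →
                       PointDetermining (F ⊕ G)
  ⊕-pointDetermining pdF pdG ni x y twins = splitAt-injective (order F)
    (reflect pdF pdG ni _ _ λ r → subst (λ s → Pointwise F._~_ G._~_ s _ ⇔ Pointwise F._~_ G._~_ s _)
      (Fin.splitAt-join (order F) (order G) r) (twins (join (order F) (order G) r)))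

  ⊕-hasNoIsolated : HasNoIsolated F → HasNoIsolated G → HasNoIsolated (F ⊕ G)
  ⊕-hasNoIsolated niF niG x with splitAt (order F) x
  ... | inj₁ y = join (order F) (order G) (inj₁ (proj₁ (niF y))) ,
                 subst (λ s → Pointwise F._~_ G._~_ s (inj₁ y))
                   (sym (Fin.splitAt-join (order F) (order G) _)) (inj₁ (proj₂ (niF y)))
  ... | inj₂ y = join (order F) (order G) (inj₂ (proj₁ (niG y))) ,
                 subst (λ s → Pointwise F._~_ G._~_ s (inj₂ y))
                   (sym (Fin.splitAt-join (order F) (order G) _)) (inj₂ (proj₂ (niG y)))

·-hasNoIsolated : ∀ m G → HasNoIsolated G → HasNoIsolated (m · G)
·-hasNoIsolated (suc m) G ni = ⊕-hasNoIsolated G (m · G) ni (·-hasNoIsolated m G ni)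

·-pointDetermining : ∀ m G → PointDetermining G → HasNoIsolated G → PointDetermining (m · G)
·-pointDetermining (suc m) G pd ni =
  ⊕-pointDetermining G (m · G) pd (·-pointDetermining m G pd ni) (·-hasNoIsolated m G ni)

-- Colourings in C n.

-- The oriented cycle underlying `C n`. With an orientation, moving along the cycle is the rotation
-- `next`, and its periods can be computed.
Arc : ∀ n → Rel (Fin n) 0ℓ
Arc n x y = toℕ y ≡ suc (toℕ x) ⊎ (suc (toℕ x) ≡ n × toℕ y ≡ 0)

next : ∀ {n} → Fin n → Fin n
next {suc n} x with suc (toℕ x) ℕ.<? suc n
... | yes lt = fromℕ< lt
... | no  _  = zero

arc-next : ∀ {n} (x : Fin n) → Arc n x (next x)
arc-next {suc n} x with suc (toℕ x) ℕ.<? suc n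
... | yes lt = inj₁ (Fin.toℕ-fromℕ< lt)
... | no ¬lt = inj₂ (ℕ.≤-antisym (Fin.toℕ<n x) (ℕ.≮⇒≥ ¬lt) , refl)

prev : ∀ {n} → Fin n → Fin n
prev {suc n} zero    = fromℕ n
prev {suc n} (suc x) = inject₁ x

arc-prev : ∀ {n} (x : Fin n) → Arc n (prev x) x
arc-prev {suc n} zero    = inj₂ (cong suc (Fin.toℕ-fromℕ n) , refl)
arc-prev {suc n} (suc x) = inj₁ (cong suc (sym (Fin.toℕ-inject₁ x)))

arc-functional : ∀ {n} {x y z : Fin n} → Arc n x y → Arc n x z → y ≡ z
arc-functional (inj₁ p) (inj₁ q) = Fin.toℕ-injective (trans p (sym q))
arc-functional {y = y} (inj₁ p) (inj₂ (q , _)) = contradiction (trans p q) (ℕ.<⇒≢ (Fin.toℕ<n y))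
arc-functional {z = z} (inj₂ (p , _)) (inj₁ q) = contradiction (trans q p) (ℕ.<⇒≢ (Fin.toℕ<n z))
arc-functional (inj₂ (_ , p)) (inj₂ (_ , q)) = Fin.toℕ-injective (trans p (sym q))

arc-cofunctional : ∀ {n} {x y z : Fin n} → Arc n x z → Arc n y z → x ≡ y
arc-cofunctional (inj₁ p) (inj₁ q) = Fin.toℕ-injective (ℕ.suc-injective (trans (sym p) q))
arc-cofunctional (inj₁ p) (inj₂ (_ , q)) = contradiction (trans (sym p) q) λ ()
arc-cofunctional (inj₂ (_ , p)) (inj₁ q) = contradiction (trans (sym q) p) λ ()
arc-cofunctional (inj₂ (p , _)) (inj₂ (q , _)) = Fin.toℕ-injective (ℕ.suc-injective (trans p (sym q)))

next-injective : ∀ {n} → Injective _≡_ _≡_ (next {n})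
next-injective {x = x} {y} eq = arc-cofunctional (arc-next x) (subst (Arc _ y) (sym eq) (arc-next y))

next-prev : ∀ {n} (x : Fin n) → next (prev x) ≡ x
next-prev x = arc-functional (arc-next (prev x)) (arc-prev x)

infixr 8 _times-next_
_times-next_ : ∀ {n} → ℕ → Fin n → Fin n
zero  times-next x = x
suc k times-next x = next (k times-next x)

-- `c` counts the passages from the last vertex to zero.
turns : ∀ {n} k (x : Fin n) → ∃[ c ] toℕ (k times-next x) + c * n ≡ k + toℕ x
turns zero x = 0 , ℕ.+-identityʳ _
turns {n} (suc k) x with turns k x | arc-next (k times-next x)
... | c , eq | inj₁ p = c , trans (cong (_+ c * n) p) (cong suc eq)
... | c , eq | inj₂ (p , q) = suc c , trans (cong (_+ suc c * n) q)
        (trans (cong (_+ c * n) (sym p)) (cong suc eq))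

period : ∀ {n} k (x : Fin n) → k times-next x ≡ x → ∃[ c ] c * n ≡ k
period {n} k x eq with turns k x
... | c , p = c , ℕ.+-cancelˡ-≡ (toℕ x) _ _
  (trans (cong (λ z → toℕ z + c * n) (sym eq)) (trans p (ℕ.+-comm k _)))

no-short-period : ∀ {n} k (x : Fin n) → 0 < k → k < n → k times-next x ≢ x
no-short-period k x 0<k k<n eq with period k x eq
... | zero  , refl = contradiction 0<k λ ()
... | suc c , refl = ℕ.<⇒≱ k<n (ℕ.m≤m+n _ _)

module _ {n : ℕ} where

  open Graph (C n) using (_~_)

  ~⇒next : ∀ {x y} → x ~ y → y ≡ next x ⊎ x ≡ next y
  ~⇒next {x} {y} (_ , inj₁ a) = inj₁ (arc-functional a (arc-next x))
  ~⇒next {x} {y} (_ , inj₂ a) = inj₂ (arc-functional a (arc-next y))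

  ~-next : 2 ≤ n → ∀ x → x ~ next x
  ~-next 2≤n x = (λ eq → no-short-period 1 x z<s 2≤n (sym eq)) , inj₁ (arc-next x)

  ~-prev : 2 ≤ n → ∀ x → prev x ~ x
  ~-prev 2≤n x = subst (prev x ~_) (next-prev x) (~-next 2≤n (prev x))

-- The cycle is one orbit of `next`: climbing from `x` reaches the last vertex, its successor is
-- zero, and climbing from zero reaches every `y`.
next-closed : ∀ {n} (S : Pred (Fin n) 0ℓ) → (∀ x → S x → S (next x)) → ∀ {x} → S x → ∀ y → S y
next-closed {suc n} S closed {x} Sx y = climb (toℕ y) zero S-zero y (sym (ℕ.+-identityʳ _))
  where
  climb : ∀ k z → S z → ∀ y → toℕ y ≡ k + toℕ z → S y
  climb zero    z Sz y eq = subst S (sym (Fin.toℕ-injective eq)) Sz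
  climb (suc k) z Sz y eq with arc-next z
  ... | inj₁ p = climb k (next z) (closed z Sz) y (trans eq (trans (sym (ℕ.+-suc k _)) (cong (k +_) (sym p))))
  ... | inj₂ (p , _) = contradiction (subst (_≤ n) (trans eq (trans (sym (ℕ.+-suc k _)) (cong (k +_) p)))
                                        (ℕ.≤-pred (Fin.toℕ<n y)))
                                     (ℕ.<⇒≱ (ℕ.m≤n+m (suc n) k))

  S-zero : S zero
  S-zero = subst S (next-prev zero)
    (closed (fromℕ n) (climb (n ∸ toℕ x) x Sx (fromℕ n)
      (trans (Fin.toℕ-fromℕ n) (sym (ℕ.m∸n+n≡m (ℕ.≤-pred (Fin.toℕ<n x)))))))

-- If `x` and `y` are distinct twins, then `next x` is a neighbour of `y` other than `next y`, so
-- `y` is two steps after `x`. By symmetry four steps lead back to `x`, so `m` divides 4.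
C-pointDetermining : ∀ {m} → 3 ≤ m → m ≢ 4 → PointDetermining (C m)
C-pointDetermining {m} 3≤m m≢4 x y twins with x Fin.≟ y
... | yes x≡y = x≡y
... | no  x≢y = contradiction
    (period 4 x (trans (cong (next ∘ next) (sym (two-steps x y x≢y (Equivalence.to ∘ twins))))
                       (sym (two-steps y x (x≢y ∘ sym) (Equivalence.from ∘ twins))))) no-4
  where
  open Graph (C m) using (_~_; symm)

  two-steps : ∀ x y → x ≢ y → (∀ z → z ~ x → z ~ y) → y ≡ next (next x)
  two-steps x y x≢y nbrs with ~⇒next (nbrs (next x) (symm (~-next (ℕ.≤-trans (ℕ.n≤1+n 2) 3≤m) x)))
  ... | inj₁ eq = eq
  ... | inj₂ eq = contradiction (next-injective eq) x≢y

  no-4 : ¬ (∃[ c ] c * m ≡ 4)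
  no-4 (zero , ())
  no-4 (suc zero , eq) = m≢4 (trans (sym (ℕ.+-identityʳ m)) eq)
  no-4 (suc (suc c) , eq) = contradiction (subst (6 ≤_) eq
    (ℕ.+-mono-≤ 3≤m (ℕ.≤-trans 3≤m (ℕ.m≤m+n m (c * m))))) λ { (s≤s (s≤s (s≤s (s≤s ())))) }

-- The image of a colouring would be closed under next, hence everything.
C-noncolourable : ∀ {m n} → 3 ≤ m → m ≢ 4 → m < n → ¬ FullColouring (C n) (C m)
C-noncolourable {m@(suc _)} {n} 3≤m m≢4 m<n (φ , hom) =
  ℕ.<⇒≱ m<n (surjective⇒≤ (next-closed (λ y → ∃[ x ] φ x ≡ y) closed (zero , refl)))
  where
  2≤m = ℕ.≤-trans (ℕ.n≤1+n 2) 3≤m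
  inj = hom-injective (C m) (C n) (C-pointDetermining 3≤m m≢4) hom

  closed : ∀ y → (∃[ x ] φ x ≡ y) → ∃[ x ] φ x ≡ next y
  closed _ (x , refl)
    with ~⇒next (Equivalence.to (hom _ _) (~-next 2≤m x))
       | ~⇒next (Equivalence.to (hom _ _) (~-prev 2≤m x))
  ... | inj₁ p | _      = next x , p
  ... | _      | inj₂ q = prev x , q
  -- Both neighbours of `x` would be mapped to the predecessor of `φ x`, hence be equal, which would
  -- give `prev x` period 2.
  ... | inj₂ p | inj₁ q = contradiction
    (inj (next-injective (trans (sym p) q)))
    λ eq → no-short-period 2 (prev x) z<s 3≤m (trans (cong next (next-prev x)) eq)

-- A colouring of a point-determining graph is injective, and each vertex of `C n` has only its
-- successor and its predecessor as neighbours.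
degree-3-noncolourable : ∀ {n G} → PointDetermining G → ∀ {z a b c} →
  a ≢ b → b ≢ c → a ≢ c → let open Graph G in z ~ a → z ~ b → z ~ c → ¬ FullColouring (C n) G
degree-3-noncolourable {n} {G} pd {z} a≢b b≢c a≢c za zb zc (φ , hom) =
  at-most-two (side za) (side zb) (side zc)
  where
  open Graph G
  inj = hom-injective G (C n) pd hom

  side : ∀ {x} → z ~ x → φ x ≡ next (φ z) ⊎ φ z ≡ next (φ x)
  side r = ~⇒next (Equivalence.to (hom _ _) r)

  out : ∀ {x y} → x ≢ y → φ x ≡ next (φ z) → φ y ≡ next (φ z) → ⊥
  out x≢y p q = x≢y (inj (trans p (sym q)))

  into : ∀ {x y} → x ≢ y → φ z ≡ next (φ x) → φ z ≡ next (φ y) → ⊥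
  into x≢y p q = x≢y (inj (next-injective (trans (sym p) q)))

  at-most-two : _ → _ → _ → ⊥
  at-most-two (inj₁ p) (inj₁ q) _        = out a≢b p q
  at-most-two (inj₁ p) (inj₂ q) (inj₁ r) = out a≢c p r
  at-most-two (inj₁ p) (inj₂ q) (inj₂ r) = into b≢c q r
  at-most-two (inj₂ p) (inj₂ q) _        = into a≢b p q
  at-most-two (inj₂ p) (inj₁ q) (inj₁ r) = out b≢c q r
  at-most-two (inj₂ p) (inj₁ q) (inj₂ r) = into a≢c p r

-- The ends may depend on `φ`: which end of a path has its successor off the image is decided by the
-- direction in which `φ` runs round the cycle.
HasEnds : ℕ → ℕ → Graph → Set
HasEnds n r G = ∀ φ → IsFullHom G (C n) φ →
  Σ[ e ∈ (Fin r → Vertex G) ] Injective _≡_ _≡_ e × (∀ j x → next (φ (e j)) ≢ φ x)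

-- A thick graph of weight w occupies w vertices of C n: the image of its
-- vertices, together with the successors of the ends.
Thick : ℕ → ℕ → Graph → Set
Thick n w G = ∃[ r ] HasEnds n r G × order G + r ≡ w

thick-noncolourable : ∀ {n w G} → PointDetermining G → Thick n w G → n < w → ¬ FullColouring (C n) G
thick-noncolourable {n} {_} {G} pd (r , ends , refl) n<w (φ , hom) with ends φ hom
... | e , e-inj , fresh = ℕ.<⇒≱ n<w (Fin.injective⇒≤ (splitAt-injective (order G) ∘ inj _ _))
  where
  ψ : Vertex G ⊎ Fin r → Fin n
  ψ = [ φ , next ∘ φ ∘ e ]′

  φ-inj = hom-injective G (C n) pd hom

  inj : ∀ s t → ψ s ≡ ψ t → s ≡ t
  inj (inj₁ x) (inj₁ y) eq = cong inj₁ (φ-inj eq)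
  inj (inj₁ x) (inj₂ j) eq = contradiction (sym eq) (fresh j x)
  inj (inj₂ i) (inj₁ y) eq = contradiction eq (fresh i y)
  inj (inj₂ i) (inj₂ j) eq = cong inj₂ (e-inj (φ-inj (next-injective eq)))

-- Were the successor of an end of one summand the image of a vertex of the other, these two
-- vertices would be adjacent. So the ends of both summands remain ends.
⊕-thick : ∀ {n v w F G} → 2 ≤ n → Thick n v F → Thick n w G → Thick n (v + w) (F ⊕ G)
⊕-thick {n} {_} {_} {F} {G} 2≤n (r , endsF , refl) (s , endsG , refl) = r + s , ends , count
  where
  count : order F + order G + (r + s) ≡ order F + r + (order G + s)
  count = trans (ℕ.+-assoc (order F) (order G) (r + s)) (trans (cong (order F +_)
    (trans (sym (ℕ.+-assoc (order G) r s)) (trans (cong (_+ s) (ℕ.+-comm (order G) r)) (ℕ.+-assoc r (order G) s))))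
    (sym (ℕ.+-assoc (order F) r (order G + s))))

  ends : HasEnds n (r + s) (F ⊕ G)
  ends φ hom = e ∘ splitAt r , (λ eq → splitAt-injective r (e-injective _ _ eq)) ,
      λ j x → subst (λ z → next (φ (e (splitAt r j))) ≢ φ z) (Fin.join-splitAt (order F) (order G) x)
                (fresh (splitAt r j) (splitAt (order F) x))
    where
    f = ⊑-⊕ˡ F G
    g = ⊑-⊕ʳ F G
    ι = join (order F) (order G)

    EF = endsF (φ ∘ ι ∘ inj₁) (λ x y → ⇔.trans (full (rel f) x y) (hom _ _))
    EG = endsG (φ ∘ ι ∘ inj₂) (λ x y → ⇔.trans (full (rel g) x y) (hom _ _))

    e : Fin r ⊎ Fin s → Vertex (F ⊕ G)
    e = ι ∘ Sum.map (proj₁ EF) (proj₁ EG)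

    e-injective : ∀ i j → e i ≡ e j → i ≡ j
    e-injective i j eq = map-injective i j (join-injective (order F) (order G) eq)
      where
      map-injective : ∀ i j → Sum.map (proj₁ EF) (proj₁ EG) i ≡ Sum.map (proj₁ EF) (proj₁ EG) j → i ≡ j
      map-injective (inj₁ _) (inj₁ _) p = cong inj₁ (proj₁ (proj₂ EF) (Sum.inj₁-injective p))
      map-injective (inj₂ _) (inj₂ _) p = cong inj₂ (proj₁ (proj₂ EG) (Sum.inj₂-injective p))

    adjacent : ∀ s t → next (φ (ι s)) ≡ φ (ι t) →
               Pointwise (Graph._~_ F) (Graph._~_ G) s t
    adjacent s t eq = subst₂ (Pointwise (Graph._~_ F) (Graph._~_ G))
      (Fin.splitAt-join (order F) (order G) s) (Fin.splitAt-join (order F) (order G) t)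
      (Equivalence.from (hom (ι s) (ι t)) (subst (Graph._~_ (C n) _) eq (~-next 2≤n (φ (ι s)))))

    fresh : ∀ i t → next (φ (e i)) ≢ φ (ι t)
    fresh (inj₁ i) (inj₁ x) eq = proj₂ (proj₂ EF) i x eq
    fresh (inj₁ i) (inj₂ y) eq with adjacent (inj₁ (proj₁ EF i)) (inj₂ y) eq
    ... | ()
    fresh (inj₂ i) (inj₁ x) eq with adjacent (inj₂ (proj₁ EG i)) (inj₁ x) eq
    ... | ()
    fresh (inj₂ i) (inj₂ y) eq = proj₂ (proj₂ EG) i y eq

empty-thick : ∀ {n} → Thick n 0 (K 0)
empty-thick = 0 , (λ _ _ → (λ ()) , (λ {}) , λ ()) , refl

·-thick : ∀ {n w G} → 2 ≤ n → ∀ m → Thick n w G → Thick n (m * w) (m · G)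
·-thick 2≤n zero    t = empty-thick
·-thick {G = G} 2≤n (suc m) t = ⊕-thick {F = G} {m · G} 2≤n t (·-thick {G = G} 2≤n m t)

-- A path in C n never turns back, so following it in one of the two
-- directions of the cycle leads to an end.
P-thick : ∀ {n} → 3 ≤ n → ∀ l → Thick n (2 + l) (P (suc l))
P-thick {n} 3≤n l = 1 , ends , ℕ.+-comm (suc l) 1
  where
  open Graph (P (suc l)) using (_~_)

  ends : HasEnds n 1 (P (suc l))
  ends φ hom with search l zero refl (λ _ ())
    where
    adjacent : ∀ {x y} → next (φ x) ≡ φ y → x ~ y
    adjacent {x} eq = Equivalence.from (hom _ _)
      (subst (Graph._~_ (C n) _) eq (~-next (ℕ.≤-trans (ℕ.n≤1+n 2) 3≤n) (φ x)))

    -- `d` vertices lie to the right of `i`, and `back` says that the walk arrived at `i` in the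
    -- direction of `next`.
    search : ∀ d (i : Fin (suc l)) → toℕ i + d ≡ l →
             (∀ p → toℕ i ≡ suc (toℕ p) → next (φ p) ≡ φ i) →
             ∃[ i ] ∀ x → next (φ i) ≢ φ x
    search d i eq back with Fin.any? (λ x → next (φ i) Fin.≟ φ x)
    ... | no none = i , λ x p → none (x , p)
    ... | yes (x , p) with adjacent p
    -- The successor of `φ i` is where the walk came from, so two steps would return to `φ i`.
    ...   | _ , inj₂ i≡1+x = contradiction (trans (cong next p) (back x i≡1+x))
                                           (no-short-period 2 (φ i) z<s 3≤n)
    ...   | _ , inj₁ x≡1+i with d
    ...     | zero  = contradiction (subst (_≤ l) x≡1+i (ℕ.≤-pred (Fin.toℕ<n x)))
                        (ℕ.<⇒≱ (s≤s (ℕ.≤-reflexive (trans (sym eq) (ℕ.+-identityʳ _)))))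
    ...     | suc d = search d x (trans (cong (_+ d) x≡1+i) (trans (sym (ℕ.+-suc _ d)) eq))
                        λ q x≡1+q → subst (λ w → next (φ w) ≡ φ x)
                          (Fin.toℕ-injective (ℕ.suc-injective (trans (sym x≡1+i) x≡1+q))) p
  ... | i , fresh = (λ _ → i) , (λ { {0F} {0F} _ → refl }) , λ _ → fresh

-- Layouts on a line.

Consecutive : {I : Set} → Rel (I ⊎ ℕ) 0ℓ
Consecutive (inj₂ i) (inj₂ j) = suc i ≡ j ⊎ suc j ≡ i
Consecutive _        _        = ⊥

consecutive? : {I : Set} → Decidable (Consecutive {I})
consecutive? (inj₂ i) (inj₂ j) = (suc i ℕ.≟ j) ⊎-dec (suc j ℕ.≟ i)
consecutive? (inj₁ _) (inj₁ _) = no id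
consecutive? (inj₁ _) (inj₂ _) = no id
consecutive? (inj₂ _) (inj₁ _) = no id

Below : {I : Set} → ℕ → Pred (I ⊎ ℕ) 0ℓ
Below w (inj₁ _) = ⊤
Below w (inj₂ i) = suc i < w

below? : {I : Set} → ∀ w (p : I ⊎ ℕ) → Dec (Below w p)
below? w (inj₁ _) = yes tt
below? w (inj₂ i) = suc i ℕ.<? w

-- A full-homomorphism from G[U] to the disjoint union of an independent set I and
-- a path on w ∸ 1 vertices; the missing vertex separates the two parts of G ⊕ H
-- in ⊕-layout.
record Layout (I : Set) (w : ℕ) (G : Graph) (U : Pred (Vertex G) 0ℓ) : Set where
  constructor layout
  field
    place : Vertex G → I ⊎ ℕ
    below : ∀ x → U x → Below w (place x)
    hom   : ∀ x y → U x → U y → Graph._~_ G x y ⇔ Consecutive (place x) (place y)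

shift : {I : Set} → ℕ → I ⊎ ℕ → I ⊎ ℕ
shift a = Sum.map₂ (a +_)

shift-below : {I : Set} → ∀ a {w} (p : I ⊎ ℕ) → Below w p → Below (a + w) (shift a p)
shift-below a         (inj₁ _) _ = tt
shift-below a {w} (inj₂ i) b = subst (_< a + w) (ℕ.+-suc a i) (ℕ.+-monoʳ-< a b)

shift-consecutive : {I : Set} → ∀ a (p q : I ⊎ ℕ) →
                    Consecutive p q ⇔ Consecutive (shift a p) (shift a q)
shift-consecutive a (inj₁ _) (inj₁ _) = ⇔.refl
shift-consecutive a (inj₁ _) (inj₂ _) = ⇔.refl
shift-consecutive a (inj₂ _) (inj₁ _) = ⇔.refl
shift-consecutive a (inj₂ i) (inj₂ j) = mk⇔
  (Sum.map (λ eq → trans (sym (ℕ.+-suc a i)) (cong (a +_) eq))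
           (λ eq → trans (sym (ℕ.+-suc a j)) (cong (a +_) eq)))
  (Sum.map (λ eq → ℕ.+-cancelˡ-≡ a _ _ (trans (ℕ.+-suc a i) eq))
           (λ eq → ℕ.+-cancelˡ-≡ a _ _ (trans (ℕ.+-suc a j) eq)))

below-mono : {I : Set} → ∀ {v w} (p : I ⊎ ℕ) → v ≤ w → Below v p → Below w p
below-mono (inj₁ _) _   _ = tt
below-mono (inj₂ _) v≤w b = ℕ.<-≤-trans b v≤w

restrict : ∀ {I w G U V} → (∀ x → V x → U x) → Layout I w G U → Layout I w G V
restrict V⊆U (layout p b h) = layout p (λ x v → b x (V⊆U x v)) (λ x y u v → h x y (V⊆U x u) (V⊆U y v))

widen : ∀ {I v w G U} → v ≤ w → Layout I v G U → Layout I w G U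
widen v≤w (layout p b h) = layout p (λ x u → below-mono (p x) v≤w (b x u)) h

allow-isolated : ∀ {w G U} → Layout ⊥ w G U → Layout ⊤ w G U
allow-isolated {w} {G} {U} (layout p b h) = layout (Sum.map₁ ⊥-elim ∘ p) b′ h′
  where
  b′ : ∀ x → U x → Below w (Sum.map₁ ⊥-elim (p x))
  b′ x u with p x | b x u
  ... | inj₂ _ | lt = lt

  h′ : ∀ x y → U x → U y → Graph._~_ G x y ⇔ Consecutive (Sum.map₁ ⊥-elim (p x)) (Sum.map₁ ⊥-elim (p y))
  h′ x y u v with p x | p y | h x y u v
  ... | inj₂ _ | inj₂ _ | e = e

-- The isolated place becomes position 0, position 1 stays empty as a separator, and everything else
-- moves up by two.
place-isolated : ∀ {w G U} → Layout ⊤ w G U → Layout ⊥ (2 + w) G U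
place-isolated {w} {G} {U} (layout p b h) = layout (inj₂ ∘ at ∘ p) b′ h′
  where
  at : ⊤ ⊎ ℕ → ℕ
  at = [ (λ _ → 0) , 2 +_ ]′

  b′ : ∀ x → U x → suc (at (p x)) < 2 + w
  b′ x u with p x | b x u
  ... | inj₁ _ | _  = s<s z<s
  ... | inj₂ _ | lt = s<s (s<s lt)

  h′ : ∀ x y → U x → U y → Graph._~_ G x y ⇔ Consecutive {⊥} (inj₂ (at (p x))) (inj₂ (at (p y)))
  h′ x y u v with p x | p y | h x y u v
  ... | inj₁ _ | inj₁ _ | e = ⇔.trans e (mk⇔ ⊥-elim λ { (inj₁ ()) ; (inj₂ ()) })
  ... | inj₁ _ | inj₂ _ | e = ⇔.trans e (mk⇔ ⊥-elim λ { (inj₁ ()) ; (inj₂ ()) })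
  ... | inj₂ _ | inj₁ _ | e = ⇔.trans e (mk⇔ ⊥-elim λ { (inj₁ ()) ; (inj₂ ()) })
  ... | inj₂ i | inj₂ j | e = ⇔.trans e (shift-consecutive {⊥} 2 (inj₂ i) (inj₂ j))

⊕-layout : ∀ {I a b F G U} → Layout I a F (U ∘ (_↑ˡ order G)) → Layout I b G (U ∘ (order F ↑ʳ_)) →
           Layout I (a + b) (F ⊕ G) U
⊕-layout {I} {a} {b} {F} {G} {U} (layout p bF hF) (layout q bG hG) =
  layout (place ∘ splitAt (order F))
         (λ x u → below (splitAt (order F) x) (on-split x u))
         (λ x y u v → hom (splitAt (order F) x) (splitAt (order F) y) (on-split x u) (on-split y v))
  where
  U′ : Pred (Vertex F ⊎ Vertex G) 0ℓ
  U′ = U ∘ join (order F) (order G)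

  on-split : ∀ x → U x → U′ (splitAt (order F) x)
  on-split x = subst U (sym (Fin.join-splitAt (order F) (order G) x))

  place : Vertex F ⊎ Vertex G → I ⊎ ℕ
  place = [ p , shift a ∘ q ]′

  below : ∀ s → U′ s → Below (a + b) (place s)
  below (inj₁ x) u = below-mono (p x) (ℕ.m≤m+n a b) (bF x u)
  below (inj₂ y) u = shift-below a (q y) (bG y u)

  apart : ∀ x y → U′ (inj₁ x) → ¬ Consecutive (p x) (shift a (q y)) × ¬ Consecutive (shift a (q y)) (p x)
  apart x y u with p x | q y | bF x u
  ... | inj₁ _ | inj₁ _ | _  = id , id
  ... | inj₁ _ | inj₂ _ | _  = id , id
  ... | inj₂ _ | inj₁ _ | _  = id , id
  ... | inj₂ i | inj₂ j | lt = [ no₁ , no₂ ]′ , [ no₂ , no₁ ]′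
    where
    no₁ : suc i ≢ a + j
    no₁ eq = ℕ.<⇒≱ (subst (_< a) eq lt) (ℕ.m≤m+n a j)
    no₂ : suc (a + j) ≢ i
    no₂ eq = ℕ.<⇒≱ (ℕ.<-trans (ℕ.n<1+n i) lt)
      (subst (a ≤_) eq (ℕ.≤-trans (ℕ.m≤m+n a j) (ℕ.n≤1+n _)))

  hom : ∀ s t → U′ s → U′ t → Pointwise (Graph._~_ F) (Graph._~_ G) s t ⇔ Consecutive (place s) (place t)
  hom (inj₁ x) (inj₁ y) u v = ⇔.trans (mk⇔ (λ { (inj₁ r) → r }) inj₁) (hF x y u v)
  hom (inj₁ x) (inj₂ y) u v = mk⇔ (λ ()) (⊥-elim ∘ proj₁ (apart x y u))
  hom (inj₂ x) (inj₁ y) u v = mk⇔ (λ ()) (⊥-elim ∘ proj₂ (apart y x v))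
  hom (inj₂ x) (inj₂ y) u v = ⇔.trans (mk⇔ (λ { (inj₂ r) → r }) inj₂)
    (⇔.trans (hG x y u v) (shift-consecutive a (q x) (q y)))

-- On `U` the positions avoid the last vertex of `C n`, and with it the arc that closes the cycle.
layout⇒colour : ∀ {n w G U} → w ≤ n → 1 ≤ n → Layout ⊥ w G U → ColourOn (C n) G U
layout⇒colour {suc n} {w} {G} {U} w≤n _ (layout p b h) = φ ∘ p , hom
  where
  -- The cap at n is for vertices outside U only.
  φ : ⊥ ⊎ ℕ → Fin (suc n)
  φ (inj₂ i) = fromℕ< (s≤s (ℕ.m⊓n≤n i n))

  toℕ-φ : ∀ {i} → suc i < w → toℕ (φ (inj₂ i)) ≡ i
  toℕ-φ lt = trans (Fin.toℕ-fromℕ< _) (ℕ.m≤n⇒m⊓n≡m (ℕ.<⇒≤ (ℕ.≤-pred (ℕ.≤-trans lt w≤n))))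

  not-last : ∀ {i} → suc i < w → suc (toℕ (φ (inj₂ i))) ≢ suc n
  not-last lt eq = ℕ.<⇒≱ (ℕ.≤-pred (ℕ.≤-trans lt w≤n)) (ℕ.≤-reflexive (trans (sym (ℕ.suc-injective eq)) (toℕ-φ lt)))

  hom : ∀ x y → U x → U y → Graph._~_ G x y ⇔ Graph._~_ (C (suc n)) (φ (p x)) (φ (p y))
  hom x y u v with p x | p y | b x u | b y v | h x y u v
  ... | inj₂ i | inj₂ j | i<w | j<w | e = ⇔.trans e (mk⇔ to′ from′)
    where
    to′ : suc i ≡ j ⊎ suc j ≡ i → Graph._~_ (C (suc n)) (φ (inj₂ i)) (φ (inj₂ j))
    to′ (inj₁ eq) = (λ φ≡ → ℕ.1+n≢n (trans eq (trans (sym (toℕ-φ j<w)) (trans (cong toℕ (sym φ≡)) (toℕ-φ i<w))))) ,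
      inj₁ (inj₁ (trans (toℕ-φ j<w) (trans (sym eq) (cong suc (sym (toℕ-φ i<w))))))
    to′ (inj₂ eq) = (λ φ≡ → ℕ.1+n≢n (trans eq (trans (sym (toℕ-φ i<w)) (trans (cong toℕ φ≡) (toℕ-φ j<w))))) ,
      inj₂ (inj₁ (trans (toℕ-φ i<w) (trans (sym eq) (cong suc (sym (toℕ-φ j<w))))))
    from′ : Graph._~_ (C (suc n)) (φ (inj₂ i)) (φ (inj₂ j)) → suc i ≡ j ⊎ suc j ≡ i
    from′ (_ , inj₁ (inj₁ eq))       = inj₁ (trans (cong suc (sym (toℕ-φ i<w))) (trans (sym eq) (toℕ-φ j<w)))
    from′ (_ , inj₁ (inj₂ (eq , _))) = contradiction eq (not-last i<w)
    from′ (_ , inj₂ (inj₁ eq))       = inj₂ (trans (cong suc (sym (toℕ-φ j<w))) (trans (sym eq) (toℕ-φ i<w)))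
    from′ (_ , inj₂ (inj₂ (eq , _))) = contradiction eq (not-last j<w)

Everywhere : {X : Set} → Pred X 0ℓ
Everywhere _ = ⊤

layout⇒colouring : ∀ {n w G} → w ≤ n → 1 ≤ n → Layout ⊥ w G Everywhere → FullColouring (C n) G
layout⇒colouring {n} {G = G} w≤n 1≤n l with layout⇒colour {n} {G = G} w≤n 1≤n l
... | φ , hom = φ , λ x y → hom x y tt tt

empty-layout : ∀ {I U} → Layout I 0 (K 0) U
empty-layout = layout (λ ()) (λ ()) (λ ())

P-layout : ∀ {I} l → Layout I (suc l) (P l) Everywhere
P-layout l = layout (inj₂ ∘ toℕ) (λ x _ → s<s (Fin.toℕ<n x)) λ x y _ _ → mk⇔
  (λ { (_ , inj₁ eq) → inj₁ (sym eq) ; (_ , inj₂ eq) → inj₂ (sym eq) })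
  (λ { (inj₁ eq) → (λ x≡y → ℕ.1+n≢n (trans eq (cong toℕ (sym x≡y)))) , inj₁ (sym eq)
     ; (inj₂ eq) → (λ x≡y → ℕ.1+n≢n (trans eq (cong toℕ x≡y))) , inj₂ (sym eq) })

-- G has a layout of width w, and deleting any vertex frees at least s units of
-- width if an isolated vertex comes for free.
record Shrinks (s w : ℕ) (G : Graph) : Set where
  field
    total    : Layout ⊥ w G Everywhere
    deletion : ∀ v → ∃[ d ] d + s ≤ w × Layout ⊤ d G (_≢ v)

-- The same when an isolated vertex is already present in G; only its own
-- deletion makes the isolated place unavailable.
record RootedShrinks (s w : ℕ) (G : Graph) : Set where
  field
    total    : Layout ⊤ w G Everywhere
    deletion : ∀ v → (∃[ d ] d + s ≤ w × Layout ⊤ d G (_≢ v)) ⊎ Layout ⊥ w G (_≢ v)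

shrinks-weaken : ∀ {s t w G} → t ≤ s → Shrinks s w G → Shrinks t w G
shrinks-weaken t≤s S = record
  { total    = total
  ; deletion = λ v → let d , le , l = deletion v in d , ℕ.≤-trans (ℕ.+-monoʳ-≤ d t≤s) le , l }
  where open Shrinks S

module _ (F G : Graph) where

  private
    sum-≤ : ∀ d {s a} b → d + s ≤ a → d + b + s ≤ a + b
    sum-≤ d {s} {a} b le = ℕ.≤-trans (ℕ.≤-reflexive
      (trans (ℕ.+-assoc d b s) (trans (cong (d +_) (ℕ.+-comm b s)) (sym (ℕ.+-assoc d s b))))) (ℕ.+-monoˡ-≤ b le)

    sum-≤ʳ : ∀ {d s b} a → d + s ≤ b → a + d + s ≤ a + b
    sum-≤ʳ {d} {s} {b} a le = ℕ.≤-trans (ℕ.≤-reflexive (ℕ.+-assoc a d s)) (ℕ.+-monoʳ-≤ a le)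

    deleteˡ : ∀ {I d b v x} → x ↑ˡ order G ≡ v → Layout I d F (_≢ x) → Layout I b G Everywhere →
              Layout I (d + b) (F ⊕ G) (_≢ v)
    deleteˡ refl l m = ⊕-layout {F = F} {G} (restrict (λ { z z≢ refl → z≢ refl }) l) (restrict (λ _ _ → tt) m)

    deleteʳ : ∀ {I a d v x} → order F ↑ʳ x ≡ v → Layout I a F Everywhere → Layout I d G (_≢ x) →
              Layout I (a + d) (F ⊕ G) (_≢ v)
    deleteʳ refl l m = ⊕-layout {F = F} {G} (restrict (λ _ _ → tt) l) (restrict (λ { z z≢ refl → z≢ refl }) m)

  ⊕-shrinks : ∀ {s a b} → Shrinks s a F → Shrinks s b G → Shrinks s (a + b) (F ⊕ G)
  ⊕-shrinks {s} {a} {b} SF SG = record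
    { total = ⊕-layout {F = F} {G} (SF .Shrinks.total) (SG .Shrinks.total)
    ; deletion = del }
    where
    del : ∀ v → ∃[ d ] d + s ≤ a + b × Layout ⊤ d (F ⊕ G) (_≢ v)
    del v with splitAt (order F) v in eq
    ... | inj₁ x = let d , le , l = SF .Shrinks.deletion x in
      d + b , sum-≤ d b le , deleteˡ (Fin.splitAt⁻¹-↑ˡ eq) l (allow-isolated (SG .Shrinks.total))
    ... | inj₂ x = let d , le , l = SG .Shrinks.deletion x in
      a + d , sum-≤ʳ a le , deleteʳ (Fin.splitAt⁻¹-↑ʳ eq) (allow-isolated (SF .Shrinks.total)) l

  ⊕-rootedShrinks : ∀ {s a b} → RootedShrinks s a F → Shrinks s b G → RootedShrinks s (a + b) (F ⊕ G)
  ⊕-rootedShrinks {s} {a} {b} RF SG = record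
    { total = ⊕-layout {F = F} {G} (RF .RootedShrinks.total) (allow-isolated (SG .Shrinks.total))
    ; deletion = del }
    where
    del : ∀ v → (∃[ d ] d + s ≤ a + b × Layout ⊤ d (F ⊕ G) (_≢ v)) ⊎ Layout ⊥ (a + b) (F ⊕ G) (_≢ v)
    del v with splitAt (order F) v in eq
    ... | inj₂ x = let d , le , l = SG .Shrinks.deletion x in
      inj₁ (a + d , sum-≤ʳ a le , deleteʳ (Fin.splitAt⁻¹-↑ʳ eq) (RF .RootedShrinks.total) l)
    ... | inj₁ x with RF .RootedShrinks.deletion x
    ...   | inj₁ (d , le , l) =
      inj₁ (d + b , sum-≤ d b le , deleteˡ (Fin.splitAt⁻¹-↑ˡ eq) l (allow-isolated (SG .Shrinks.total)))
    ...   | inj₂ l = inj₂ (deleteˡ (Fin.splitAt⁻¹-↑ˡ eq) l (SG .Shrinks.total))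

·-shrinks : ∀ {s w} m G → Shrinks s w G → Shrinks s (m * w) (m · G)
·-shrinks zero    G S = record { total = empty-layout ; deletion = λ () }
·-shrinks (suc m) G S = ⊕-shrinks G (m · G) S (·-shrinks m G S)

-- The root uses only the isolated place, so its width is 0. Its sole deletion falls under the
-- second alternative, where nothing remains to be placed, so every `s` is allowed.
K₁-rootedShrinks : ∀ {s} → RootedShrinks s 0 (K 1)
K₁-rootedShrinks = record
  { total    = layout (λ _ → inj₁ tt) (λ _ _ → tt) λ { 0F 0F _ _ → mk⇔ (λ (0≢0 , _) → 0≢0 refl) λ () }
  ; deletion = λ { 0F → inj₂ (layout (λ _ → inj₂ 0) (λ { 0F 0≢0 → contradiction refl 0≢0 })
                                     (λ { 0F _ 0≢0 → contradiction refl 0≢0 })) }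
  }

-- Vertex deletions in small graphs, checked by tables.

does-⇔ : {A B : Set} (a? : Dec A) (b? : Dec B) → does a? ≡ does b? → A ⇔ B
does-⇔ (yes a) (yes b) _ = mk⇔ (λ _ → b) (λ _ → a)
does-⇔ (no ¬a) (no ¬b) _ = mk⇔ (λ a → contradiction a ¬a) (λ b → contradiction b ¬b)

module _ {I : Set} (w : ℕ) (G : Graph) (table : Vertex G → Vertex G → I ⊎ ℕ) where

  open Graph G

  -- Comparing Booleans instead of propositions makes the condition decidable by evaluation on a
  -- concrete table.
  IsDeletionTable : Set
  IsDeletionTable = ∀ v x → x ≡ v ⊎ (Below w (table v x) ×
    (∀ y → y ≡ v ⊎ does (x ~? y) ≡ does (consecutive? (table v x) (table v y))))

  isDeletionTable? : Dec IsDeletionTable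
  isDeletionTable? = Fin.all? λ v → Fin.all? λ x → (x Fin.≟ v) ⊎-dec (below? w (table v x) ×-dec
    Fin.all? λ y → (y Fin.≟ v) ⊎-dec (does (x ~? y) Bool.≟ does (consecutive? (table v x) (table v y))))

  deletionTable⇒layout : IsDeletionTable → ∀ v → Layout I w G (_≢ v)
  deletionTable⇒layout ok v = layout (table v) b h
    where
    b : ∀ x → x ≢ v → Below w (table v x)
    b x x≢v with ok v x
    ... | inj₁ x≡v     = contradiction x≡v x≢v
    ... | inj₂ (p , _) = p

    h : ∀ x y → x ≢ v → y ≢ v → (x ~ y) ⇔ Consecutive (table v x) (table v y)
    h x y x≢v y≢v with ok v x
    ... | inj₁ x≡v     = contradiction x≡v x≢v
    ... | inj₂ (_ , r) with r y
    ...   | inj₁ y≡v = contradiction y≡v y≢v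
    ...   | inj₂ eq  = does-⇔ (x ~? y) (consecutive? (table v x) (table v y)) eq

Table : Set → ℕ → Set
Table I m = Vec (Vec (I ⊎ ℕ) m) m

entry : ∀ {I m} → Table I m → Fin m → Fin m → I ⊎ ℕ
entry T v x = lookup (lookup T v) x

private
  pattern ○ = inj₁ tt
  pattern at i = inj₂ i

-- Row v places the vertices other than v; its diagonal entry is irrelevant.

tableK₂ : Table ⊤ 2
tableK₂ = (○ ∷ ○ ∷ []) ∷ (○ ∷ ○ ∷ []) ∷ []

tableP₄ : Table ⊤ 4
tableP₄ =
  (○    ∷ at 0 ∷ at 1 ∷ at 0 ∷ []) ∷
  (○    ∷ ○    ∷ at 0 ∷ at 1 ∷ []) ∷
  (at 0 ∷ at 1 ∷ ○    ∷ ○    ∷ []) ∷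
  (at 0 ∷ at 1 ∷ at 0 ∷ ○    ∷ []) ∷ []

tableP₆ : Table ⊤ 6
tableP₆ =
  (○    ∷ at 0 ∷ at 1 ∷ at 2 ∷ at 3 ∷ at 4 ∷ []) ∷
  (○    ∷ ○    ∷ at 0 ∷ at 1 ∷ at 2 ∷ at 3 ∷ []) ∷
  (at 0 ∷ at 1 ∷ ○    ∷ at 3 ∷ at 4 ∷ at 3 ∷ []) ∷
  (at 0 ∷ at 1 ∷ at 0 ∷ ○    ∷ at 3 ∷ at 4 ∷ []) ∷
  (at 0 ∷ at 1 ∷ at 2 ∷ at 3 ∷ ○    ∷ ○    ∷ []) ∷
  (at 0 ∷ at 1 ∷ at 2 ∷ at 3 ∷ at 4 ∷ ○    ∷ []) ∷ []

tableA : Table ⊥ 6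
tableA =
  (at 0 ∷ at 2 ∷ at 3 ∷ at 2 ∷ at 1 ∷ at 0 ∷ []) ∷
  (at 0 ∷ at 0 ∷ at 2 ∷ at 3 ∷ at 4 ∷ at 5 ∷ []) ∷
  (at 0 ∷ at 1 ∷ at 0 ∷ at 3 ∷ at 2 ∷ at 3 ∷ []) ∷
  (at 0 ∷ at 1 ∷ at 0 ∷ at 0 ∷ at 2 ∷ at 3 ∷ []) ∷
  (at 2 ∷ at 3 ∷ at 4 ∷ at 5 ∷ at 0 ∷ at 0 ∷ []) ∷
  (at 0 ∷ at 1 ∷ at 2 ∷ at 3 ∷ at 2 ∷ at 0 ∷ []) ∷ []

tableB : Table ⊥ 6
tableB =
  (at 0 ∷ at 2 ∷ at 3 ∷ at 2 ∷ at 1 ∷ at 0 ∷ []) ∷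
  (at 0 ∷ at 0 ∷ at 4 ∷ at 3 ∷ at 2 ∷ at 1 ∷ []) ∷
  (at 3 ∷ at 2 ∷ at 0 ∷ at 0 ∷ at 1 ∷ at 2 ∷ []) ∷
  (at 2 ∷ at 1 ∷ at 0 ∷ at 0 ∷ at 2 ∷ at 3 ∷ []) ∷
  (at 1 ∷ at 2 ∷ at 3 ∷ at 4 ∷ at 0 ∷ at 0 ∷ []) ∷
  (at 0 ∷ at 1 ∷ at 2 ∷ at 3 ∷ at 2 ∷ at 0 ∷ []) ∷ []

tableE : Table ⊥ 6
tableE =
  (at 0 ∷ at 3 ∷ at 4 ∷ at 5 ∷ at 2 ∷ at 0 ∷ []) ∷
  (at 2 ∷ at 0 ∷ at 5 ∷ at 6 ∷ at 0 ∷ at 3 ∷ []) ∷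
  (at 4 ∷ at 3 ∷ at 0 ∷ at 0 ∷ at 2 ∷ at 5 ∷ []) ∷
  (at 1 ∷ at 2 ∷ at 3 ∷ at 0 ∷ at 3 ∷ at 0 ∷ []) ∷
  (at 1 ∷ at 2 ∷ at 3 ∷ at 4 ∷ at 0 ∷ at 0 ∷ []) ∷
  (at 3 ∷ at 2 ∷ at 1 ∷ at 0 ∷ at 3 ∷ at 0 ∷ []) ∷ []

P₂≈K₂ : ∀ x y → Graph._~_ (P 2) x y ⇔ Graph._~_ (K 2) x y
P₂≈K₂ x y = from-yes (Fin.all? λ x → Fin.all? λ y → P₂≈K₂? x y) x y
  where
  P₂≈K₂? : ∀ x y → Dec (Graph._~_ (P 2) x y ⇔ Graph._~_ (K 2) x y)
  P₂≈K₂? x y = map′ (λ (f , g) → mk⇔ f g) (λ e → Equivalence.to e , Equivalence.from e)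
    ((Graph._~?_ (P 2) x y →-dec Graph._~?_ (K 2) x y) ×-dec (Graph._~?_ (K 2) x y →-dec Graph._~?_ (P 2) x y))

K₂-shrinks : Shrinks 3 3 (K 2)
K₂-shrinks = record
  { total    = let open Layout (P-layout 2) in
      layout place below λ x y u v → ⇔.trans (⇔.sym (P₂≈K₂ x y)) (hom x y u v)
  ; deletion = λ v → 0 , ℕ.≤-refl ,
      deletionTable⇒layout 0 (K 2) (entry tableK₂) (from-yes (isDeletionTable? 0 (K 2) (entry tableK₂))) v
  }

-- A deletion leaves `P 3`, whose ends are twins and share a place, or an isolated vertex with an
-- edge. Either way one edge, of width 3, has to be placed on the line.
P₄-shrinks : Shrinks 2 5 (P 4)
P₄-shrinks = record
  { total    = P-layout 4
  ; deletion = λ v → 3 , ℕ.≤-refl ,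
      deletionTable⇒layout 3 (P 4) (entry tableP₄) (from-yes (isDeletionTable? 3 (P 4) (entry tableP₄))) v
  }

-- The costly deletions leave `P 5`, or `P 2` and a `P 3` with its ends merged; both have width 6.
-- The remaining ones leave `P 4` and an isolated vertex.
P₆-shrinks : Shrinks 1 7 (P 6)
P₆-shrinks = record
  { total    = P-layout 6
  ; deletion = λ v → 6 , ℕ.≤-refl ,
      deletionTable⇒layout 6 (P 6) (entry tableP₆) (from-yes (isDeletionTable? 6 (P 6) (entry tableP₆))) v
  }

-- Without vertex 1 the graphs `A`, `B` and `E` become K₁ + P₄, P₅ and K₁ + 2K₂, of weights 7, 6 and
-- 8. No other deletion needs more width, and these widths are the least `n` for which the three
-- graphs are listed.
A-deletion : ∀ v → Layout ⊥ 7 A (_≢ v)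
A-deletion = deletionTable⇒layout 7 A (entry tableA) (from-yes (isDeletionTable? 7 A (entry tableA)))

B-deletion : ∀ v → Layout ⊥ 6 B (_≢ v)
B-deletion = deletionTable⇒layout 6 B (entry tableB) (from-yes (isDeletionTable? 6 B (entry tableB)))

E-deletion : ∀ v → Layout ⊥ 8 E (_≢ v)
E-deletion = deletionTable⇒layout 8 E (entry tableE) (from-yes (isDeletionTable? 8 E (entry tableE)))

-- The listed graphs are minimal obstructions.

P-edge : ∀ {l} {x y : Fin l} → toℕ y ≡ suc (toℕ x) → Graph._~_ (P l) x y
P-edge eq = (λ x≡y → ℕ.1+n≢n (trans (sym eq) (cong toℕ (sym x≡y)))) , inj₁ eq

P-hasNoIsolated : ∀ l → HasNoIsolated (P (2 + l))
P-hasNoIsolated l zero    = suc zero , (λ ()) , inj₂ refl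
P-hasNoIsolated l (suc x) = inject₁ x , P-edge (cong suc (sym (Fin.toℕ-inject₁ x)))

-- If `x` is not zero, its predecessor separates it from every later `y`. If `x` is zero, vertex 1
-- does so, except against `y = 2`, where vertex 3 is required.
P-distinguishes : ∀ {l} → l ≢ 3 → (x y : Fin l) → toℕ x < toℕ y →
                  ¬ (∀ z → Graph._~_ (P l) z x ⇔ Graph._~_ (P l) z y)
P-distinguishes l≢3 zero (suc zero) _ twins with Equivalence.to (twins 1F) ((λ ()) , inj₂ refl)
... | 1≢1 , _ = 1≢1 refl
P-distinguishes {3} l≢3 zero (suc (suc zero)) _ twins = l≢3 refl
P-distinguishes {suc (suc (suc (suc l)))} l≢3 zero (suc (suc zero)) _ twins
  with Equivalence.from (twins 3F) ((λ ()) , inj₂ refl)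
... | _ , inj₁ ()
... | _ , inj₂ ()
P-distinguishes l≢3 zero (suc (suc (suc y))) _ twins with Equivalence.to (twins 1F) ((λ ()) , inj₂ refl)
... | _ , inj₁ ()
... | _ , inj₂ ()
P-distinguishes l≢3 (suc x) y x<y twins
  with Equivalence.to (twins (inject₁ x)) (P-edge (cong suc (sym (Fin.toℕ-inject₁ x))))
... | _ , inj₁ eq = ℕ.<⇒≢ x<y (trans (cong suc (sym (Fin.toℕ-inject₁ x))) (sym eq))
... | _ , inj₂ eq = ℕ.<⇒≱ x<y (ℕ.≤-trans (ℕ.n≤1+n _)
  (ℕ.≤-trans (ℕ.≤-reflexive (trans (sym eq) (Fin.toℕ-inject₁ x))) (ℕ.n≤1+n _)))

P-pointDetermining : ∀ {l} → l ≢ 3 → PointDetermining (P l)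
P-pointDetermining l≢3 x y twins with Fin.<-cmp x y
... | tri< x<y _ _ = ⊥-elim (P-distinguishes l≢3 x y x<y twins)
... | tri≈ _ x≡y _ = x≡y
... | tri> _ _ y<x = ⊥-elim (P-distinguishes l≢3 y x y<x (⇔.sym ∘ twins))

-- Cycles with one vertex deleted.

module _ {m : ℕ} (v : Fin m) where

  -- The distance travelled forward from the successor of `v`. It unrolls `C m` without `v` into a
  -- path on the positions 0 to m - 2.
  offset : Fin m → ℕ
  offset x with toℕ v ℕ.<? toℕ x
  ... | yes _ = toℕ x ∸ suc (toℕ v)
  ... | no  _ = toℕ x + (m ∸ suc (toℕ v))

  -- The value of `offset` with `suc (toℕ v)` added on both sides, which removes the truncated
  -- subtraction.
  After Before : Fin m → Set
  After  x = toℕ v < toℕ x × offset x + suc (toℕ v) ≡ toℕ x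
  Before x = toℕ x < toℕ v × offset x + suc (toℕ v) ≡ toℕ x + m

  offset-spec : ∀ x → x ≢ v → After x ⊎ Before x
  offset-spec x x≢v with toℕ v ℕ.<? toℕ x
  ... | yes v<x = inj₁ (v<x , ℕ.m∸n+n≡m v<x)
  ... | no  v≮x = inj₂ (ℕ.≤∧≢⇒< (ℕ.≮⇒≥ v≮x) (x≢v ∘ Fin.toℕ-injective) ,
    trans (ℕ.+-assoc (toℕ x) _ _) (cong (toℕ x +_) (ℕ.m∸n+n≡m (Fin.toℕ<n v))))

  offset-< : ∀ x → x ≢ v → suc (offset x) < m
  offset-< x x≢v with offset-spec x x≢v
  ... | inj₁ (_ , eq) = ℕ.≤-<-trans
    (subst (suc (offset x) ≤_) eq (subst (suc (offset x) ≤_) (sym (ℕ.+-suc (offset x) _)) (s≤s (ℕ.m≤m+n _ _))))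
    (Fin.toℕ<n x)
  ... | inj₂ (x<v , eq) = ℕ.+-cancelʳ-≤ (toℕ v) _ _ (subst (_≤ m + toℕ v)
    (trans (cong suc (sym eq)) (cong suc (ℕ.+-suc (offset x) (toℕ v))))
    (subst (suc (toℕ x) + m ≤_) (ℕ.+-comm (toℕ v) m) (ℕ.+-monoˡ-≤ m x<v)))

  arc⇒consecutive : ∀ {x y} → x ≢ v → y ≢ v → Arc m x y → suc (offset x) ≡ offset y
  arc⇒consecutive {x} {y} x≢v y≢v a with offset-spec x x≢v | offset-spec y y≢v | a
  ... | inj₁ (_ , p) | inj₁ (_ , q) | inj₁ r =
    ℕ.+-cancelʳ-≡ _ _ _ (trans (cong suc p) (trans (sym r) (sym q)))
  ... | inj₂ (_ , p) | inj₂ (_ , q) | inj₁ r =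
    ℕ.+-cancelʳ-≡ _ _ _ (trans (cong suc p) (trans (cong (_+ m) (sym r)) (sym q)))
  ... | inj₁ (v<x , _) | inj₂ (y<v , _) | inj₁ r =
    contradiction (subst (_≤ toℕ v) (cong suc r) y<v) (ℕ.<⇒≱ (ℕ.<-trans v<x (ℕ.≤-trans (ℕ.n<1+n _) (ℕ.n≤1+n _))))
  ... | inj₂ (x<v , _) | inj₁ (v<y , _) | inj₁ r =
    contradiction (ℕ.≤-pred (subst (suc (toℕ v) ≤_) r v<y)) (ℕ.<⇒≱ x<v)
  -- The closing arc is the only one that leads from the vertices after `v` to those before it, and
  -- there the offsets do not jump.
  ... | inj₁ (_ , p) | inj₂ (_ , q) | inj₂ (r , s) =
    ℕ.+-cancelʳ-≡ _ _ _ (trans (cong suc p) (trans r (trans (cong (_+ m) (sym s)) (sym q))))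
  ... | _ | inj₁ (v<y , _) | inj₂ (_ , s) = contradiction (subst (toℕ v <_) s v<y) λ ()
  ... | inj₂ (x<v , _) | inj₂ _ | inj₂ (r , _) =
    contradiction (Fin.toℕ<n v) (ℕ.≤⇒≯ (subst (_≤ toℕ v) r x<v))

  consecutive⇒arc : ∀ {x y} → x ≢ v → y ≢ v → suc (offset x) ≡ offset y → Arc m x y
  consecutive⇒arc {x} {y} x≢v y≢v r with offset-spec x x≢v | offset-spec y y≢v
  ... | inj₁ (_ , p) | inj₁ (_ , q) = inj₁ (trans (sym q) (trans (cong (_+ _) (sym r)) (cong suc p)))
  ... | inj₂ (_ , p) | inj₂ (_ , q) = inj₁ (ℕ.+-cancelʳ-≡ m _ _
    (trans (sym q) (trans (cong (_+ _) (sym r)) (cong suc p))))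
  ... | inj₁ (_ , p) | inj₂ (_ , q) = inj₂ (trans (sym y+m) (cong (_+ m) y≡0) , y≡0)
    where
    y+m : toℕ y + m ≡ suc (toℕ x)
    y+m = trans (sym q) (trans (cong (_+ _) (sym r)) (cong suc p))
    y≡0 : toℕ y ≡ 0
    y≡0 = ℕ.n≤0⇒n≡0 (ℕ.+-cancelʳ-≤ m _ _ (subst (_≤ m) (sym y+m) (Fin.toℕ<n x)))
  ... | inj₂ (_ , p) | inj₁ (_ , q) = contradiction (Fin.toℕ<n y)
    (ℕ.≤⇒≯ (subst (m ≤_) (trans (cong suc (sym p)) (trans (cong (_+ _) r) q)) (ℕ.m≤n+m m (suc (toℕ x)))))

  C-deletion : Layout ⊥ m (C m) (_≢ v)
  C-deletion = layout (inj₂ ∘ offset) offset-< λ x y x≢v y≢v → mk⇔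
    (λ (_ , r) → Sum.map (arc⇒consecutive x≢v y≢v) (arc⇒consecutive y≢v x≢v) r)
    (λ c → [ (λ eq x≡y → ℕ.1+n≢n (trans eq (cong offset (sym x≡y))))
           , (λ eq x≡y → ℕ.1+n≢n (trans eq (cong offset x≡y))) ]′ c ,
           Sum.map (consecutive⇒arc x≢v y≢v) (consecutive⇒arc y≢v x≢v) c)

-- Small point-determining graphs, and vertices of degree three in `A`, `B` and `E`.

isPointDetermining? : ∀ G → Dec (∀ x y → x ≡ y ⊎ ∃ (Distinguishes G x y))
isPointDetermining? G = Fin.all? λ x → Fin.all? λ y → (x Fin.≟ y) ⊎-dec Fin.any? (distinguishes? G x y)

distinguished⇒pointDetermining : ∀ G → (∀ x y → x ≡ y ⊎ ∃ (Distinguishes G x y)) → PointDetermining G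
distinguished⇒pointDetermining G d x y twins with d x y
... | inj₁ x≡y                  = x≡y
... | inj₂ (z , inj₁ (p , ¬q)) = contradiction (Equivalence.to (twins z) p) ¬q
... | inj₂ (z , inj₂ (¬p , q)) = contradiction (Equivalence.from (twins z) q) ¬p

A-pointDetermining : PointDetermining A
A-pointDetermining = distinguished⇒pointDetermining A (from-yes (isPointDetermining? A))

B-pointDetermining : PointDetermining B
B-pointDetermining = distinguished⇒pointDetermining B (from-yes (isPointDetermining? B))

E-pointDetermining : PointDetermining E
E-pointDetermining = distinguished⇒pointDetermining E (from-yes (isPointDetermining? E))

K₁-pointDetermining : PointDetermining (K 1)
K₁-pointDetermining 0F 0F _ = refl

K₂-pointDetermining : PointDetermining (K 2)
K₂-pointDetermining = distinguished⇒pointDetermining (K 2) (from-yes (isPointDetermining? (K 2)))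

K₂-hasNoIsolated : HasNoIsolated (K 2)
K₂-hasNoIsolated 0F = 1F , (λ ()) , inj₁ tt
K₂-hasNoIsolated 1F = 0F , (λ ()) , inj₁ tt

A-noncolourable : ∀ {n} → ¬ FullColouring (C n) A
A-noncolourable = degree-3-noncolourable {G = A} A-pointDetermining {1F} {0F} {2F} {4F} (λ ()) (λ ()) (λ ())
  (from-yes (Graph._~?_ A 1F 0F)) (from-yes (Graph._~?_ A 1F 2F)) (from-yes (Graph._~?_ A 1F 4F))

B-noncolourable : ∀ {n} → ¬ FullColouring (C n) B
B-noncolourable = degree-3-noncolourable {G = B} B-pointDetermining {1F} {0F} {2F} {4F} (λ ()) (λ ()) (λ ())
  (from-yes (Graph._~?_ B 1F 0F)) (from-yes (Graph._~?_ B 1F 2F)) (from-yes (Graph._~?_ B 1F 4F))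

E-noncolourable : ∀ {n} → ¬ FullColouring (C n) E
E-noncolourable = degree-3-noncolourable {G = E} E-pointDetermining {1F} {0F} {2F} {4F} (λ ()) (λ ()) (λ ())
  (from-yes (Graph._~?_ E 1F 0F)) (from-yes (Graph._~?_ E 1F 2F)) (from-yes (Graph._~?_ E 1F 4F))

-- The listed linear forests.

LF₂-graph : ℕ → ℕ → Graph
LF₂-graph m₂ m₄ = K 1 ⊕ m₂ · K 2 ⊕ m₄ · P 4

LF₃-graph : ℕ → ℕ → ℕ → Graph
LF₃-graph m₂ m₄ m₆ = LF₂-graph m₂ m₄ ⊕ m₆ · P 6

module _ {n : ℕ} (3≤n : 3 ≤ n) where

  private
    2≤n = ℕ.≤-trans (ℕ.n≤1+n 2) 3≤n
    1≤n = ℕ.≤-trans (ℕ.n≤1+n 1) 2≤n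

  obs-by-layouts : ∀ {w G} → ¬ FullColouring (C n) G → w ≤ n → (∀ v → Layout ⊥ w G (_≢ v)) → obs (C n) G
  obs-by-layouts {G = G} ¬col w≤n del =
    obs-by-deletion (C n) G ¬col λ v → layout⇒colour {G = G} w≤n 1≤n (del v)

  K₁-thick : Thick n 2 (K 1)
  K₁-thick = 1 , (λ φ hom → proj₁ (proj₂ (P-thick 3≤n 0)) φ
    (λ { 0F 0F → ⇔.trans (mk⇔ (λ (0≢0 , _) → contradiction refl 0≢0) (λ (0≢0 , _) → contradiction refl 0≢0)) (hom 0F 0F) })) , refl

  K₂-thick : Thick n 3 (K 2)
  K₂-thick = 1 , (λ φ hom → proj₁ (proj₂ (P-thick 3≤n 1)) φ (λ x y → ⇔.trans (P₂≈K₂ x y) (hom x y))) , refl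

  -- If the root survives the deletion, a width `d` remains and the isolated place costs 2 more;
  -- `2 + w ≤ n + s` is what makes `2 + d ≤ n`. If the root is deleted, the width `w` alone has to
  -- fit.
  rooted-obs : ∀ {s w} G → ¬ FullColouring (C n) G → RootedShrinks s w G →
               w ≤ n → 2 + w ≤ n + s → obs (C n) G
  rooted-obs {s} {w} G ¬col S w≤n 2+w≤n+s = obs-by-layouts {G = G} ¬col ℕ.≤-refl del
    where
    del : ∀ v → Layout ⊥ n G (_≢ v)
    del v with S .RootedShrinks.deletion v
    ... | inj₁ (d , le , l) = widen
      (ℕ.+-cancelʳ-≤ s _ _ (ℕ.≤-trans (s≤s (s≤s le)) 2+w≤n+s)) (place-isolated l)
    ... | inj₂ l = widen w≤n l

  -- The weight is n + 1. Deleting a vertex frees the three units of its `K 2`, and two are spent on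
  -- its former neighbour.
  LF₁-obs : ∀ m₂ → 3 * m₂ ≡ suc n → obs (C n) (m₂ · K 2)
  LF₁-obs m₂ eq = obs-by-layouts {G = m₂ · K 2}
    (thick-noncolourable {G = m₂ · K 2} (·-pointDetermining m₂ (K 2) K₂-pointDetermining K₂-hasNoIsolated)
      (·-thick {G = K 2} 2≤n m₂ K₂-thick) (ℕ.≤-reflexive (sym eq′)))
    ℕ.≤-refl
    λ v → let d , le , l = ·-shrinks m₂ (K 2) K₂-shrinks .Shrinks.deletion v in widen
      (ℕ.≤-pred (subst₂ _≤_ (ℕ.+-comm d 3) eq′ le)) (place-isolated l)
    where
    eq′ = trans (ℕ.*-comm m₂ 3) eq

  module _ (m₂ m₄ : ℕ) where

    private
      LF₂-pd : PointDetermining (LF₂-graph m₂ m₄)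
      LF₂-pd = ⊕-pointDetermining (K 1 ⊕ m₂ · K 2) (m₄ · P 4)
        (⊕-pointDetermining (K 1) (m₂ · K 2) K₁-pointDetermining
          (·-pointDetermining m₂ (K 2) K₂-pointDetermining K₂-hasNoIsolated)
          (·-hasNoIsolated m₂ (K 2) K₂-hasNoIsolated))
        (·-pointDetermining m₄ (P 4) (P-pointDetermining λ ()) (P-hasNoIsolated 2))
        (·-hasNoIsolated m₄ (P 4) (P-hasNoIsolated 2))

      LF₂-thick : Thick n (2 + (m₂ * 3 + m₄ * 5)) (LF₂-graph m₂ m₄)
      LF₂-thick = ⊕-thick {F = K 1 ⊕ m₂ · K 2} {m₄ · P 4} 2≤n
        (⊕-thick {F = K 1} {m₂ · K 2} 2≤n K₁-thick (·-thick {G = K 2} 2≤n m₂ K₂-thick))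
        (·-thick {G = P 4} 2≤n m₄ (P-thick 3≤n 3))

      LF₂-shrinks : RootedShrinks 2 (m₂ * 3 + m₄ * 5) (LF₂-graph m₂ m₄)
      LF₂-shrinks = ⊕-rootedShrinks (K 1 ⊕ m₂ · K 2) (m₄ · P 4)
        (⊕-rootedShrinks (K 1) (m₂ · K 2) K₁-rootedShrinks (shrinks-weaken (ℕ.n≤1+n 2) (·-shrinks m₂ (K 2) K₂-shrinks)))
        (·-shrinks m₄ (P 4) P₄-shrinks)

    LF₂-noncolourable : n < 2 + (m₂ * 3 + m₄ * 5) → ¬ FullColouring (C n) (LF₂-graph m₂ m₄)
    LF₂-noncolourable = thick-noncolourable {G = LF₂-graph m₂ m₄} LF₂-pd LF₂-thick

    -- The weight is n + 2, so a deletion must save two units, as those in `K 2` and `P 4` do.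
    LF₂-obs : 3 * m₂ + 5 * m₄ ≡ n → obs (C n) (LF₂-graph m₂ m₄)
    LF₂-obs eq = rooted-obs (LF₂-graph m₂ m₄)
      (LF₂-noncolourable (subst (λ w → n < 2 + w) (sym eq′) (ℕ.n≤1+n _))) LF₂-shrinks (ℕ.≤-reflexive eq′)
      (ℕ.≤-reflexive (trans (cong (2 +_) eq′) (ℕ.+-comm 2 n)))
      where eq′ = trans (cong₂ _+_ (ℕ.*-comm m₂ 3) (ℕ.*-comm m₄ 5)) eq

    module _ (m₆ : ℕ) where

      private
        LF₃-pd : PointDetermining (LF₃-graph m₂ m₄ m₆)
        LF₃-pd = ⊕-pointDetermining (LF₂-graph m₂ m₄) (m₆ · P 6) LF₂-pd
          (·-pointDetermining m₆ (P 6) (P-pointDetermining λ ()) (P-hasNoIsolated 4))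
          (·-hasNoIsolated m₆ (P 6) (P-hasNoIsolated 4))

        LF₃-thick : Thick n (2 + (m₂ * 3 + m₄ * 5 + m₆ * 7)) (LF₃-graph m₂ m₄ m₆)
        LF₃-thick = ⊕-thick {F = LF₂-graph m₂ m₄} {m₆ · P 6} 2≤n LF₂-thick
          (·-thick {G = P 6} 2≤n m₆ (P-thick 3≤n 5))

        LF₃-shrinks : RootedShrinks 1 (m₂ * 3 + m₄ * 5 + m₆ * 7) (LF₃-graph m₂ m₄ m₆)
        LF₃-shrinks = ⊕-rootedShrinks (LF₂-graph m₂ m₄) (m₆ · P 6)
          (⊕-rootedShrinks (K 1 ⊕ m₂ · K 2) (m₄ · P 4)
            (⊕-rootedShrinks (K 1) (m₂ · K 2) K₁-rootedShrinks
              (shrinks-weaken (s≤s z≤n) (·-shrinks m₂ (K 2) K₂-shrinks)))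
            (shrinks-weaken (s≤s z≤n) (·-shrinks m₄ (P 4) P₄-shrinks)))
          (·-shrinks m₆ (P 6) P₆-shrinks)

      -- The weight is n + 1, so saving one unit is enough and `P 6` may occur.
      LF₃-obs : suc (3 * m₂ + 5 * m₄ + 7 * m₆) ≡ n → obs (C n) (LF₃-graph m₂ m₄ m₆)
      LF₃-obs eq = rooted-obs (LF₃-graph m₂ m₄ m₆)
        (thick-noncolourable {G = LF₃-graph m₂ m₄ m₆} LF₃-pd LF₃-thick (ℕ.≤-reflexive (cong suc (sym eq′))))
        LF₃-shrinks (ℕ.≤-trans (ℕ.n≤1+n _) (ℕ.≤-reflexive eq′))
        (ℕ.≤-reflexive (trans (cong suc eq′) (ℕ.+-comm 1 n)))
        where eq′ = trans (cong suc (cong₂ _+_ (cong₂ _+_ (ℕ.*-comm m₂ 3) (ℕ.*-comm m₄ 5)) (ℕ.*-comm m₆ 7))) eq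

listed⇒obs : ∀ n → 5 ≤ n → ∀ {G} → (CycleFamily (n ∸ 2) ∪ LF (n ∸ 1) ∪ O (n ∸ 1)) G → obs (C n) G
listed⇒obs (suc zero) (s≤s ())
listed⇒obs n@(suc n-1@(suc n-2)) 5≤n = go
  where
  3≤n = ℕ.≤-trans (s≤s (s≤s (s≤s z≤n))) 5≤n

  go : ∀ {G} → (CycleFamily n-2 ∪ LF n-1 ∪ O n-1) G → obs (C n) G
  go (inj₁ triangle) = obs-by-layouts 3≤n {G = C 3} (C-noncolourable ℕ.≤-refl (λ ()) (ℕ.≤-trans (s≤s (s≤s (s≤s (s≤s z≤n)))) 5≤n))
    3≤n C-deletion
  go (inj₁ (cycle m 5≤m m≤)) = obs-by-layouts 3≤n {G = C m}
    (C-noncolourable (ℕ.≤-trans (s≤s (s≤s (s≤s z≤n))) 5≤m) (λ { refl → contradiction 5≤m λ { (s≤s (s≤s (s≤s (s≤s ())))) } }) m<n)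
    (ℕ.<⇒≤ m<n) C-deletion
    where m<n = s≤s (subst (m ≤_) (ℕ.+-comm n-2 1) m≤)
  go (inj₂ (inj₁ (inj₁ (lf₁ m₂ eq)))) = LF₁-obs 3≤n m₂ (trans eq (ℕ.+-comm n-1 2))
  go (inj₂ (inj₁ (inj₂ (inj₁ (lf₂ m₂ m₄ eq))))) = LF₂-obs 3≤n m₂ m₄ (trans eq (ℕ.+-comm n-1 1))
  go (inj₂ (inj₁ (inj₂ (inj₂ (lf₃ m₂ m₄ m₆ eq))))) = LF₃-obs 3≤n m₂ m₄ m₆ (cong suc eq)
  go (inj₂ (inj₂ (B∈O 5≤k))) = obs-by-layouts 3≤n {G = B} B-noncolourable (s≤s 5≤k) B-deletion
  go (inj₂ (inj₂ (A∈O 6≤k))) = obs-by-layouts 3≤n {G = A} A-noncolourable (s≤s 6≤k) A-deletion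
  go (inj₂ (inj₂ (E∈O 7≤k))) = obs-by-layouts 3≤n {G = E} E-noncolourable (s≤s 7≤k) E-deletion

-- Recognising small induced subgraphs.

Agree : (F G : Graph) → (Vertex F → Vertex G) → Vertex F → Vertex F → Set
Agree F G f i j = if does (Graph._~?_ F i j) then f i ~ f j else ¬ f i ~ f j
  where open Graph G

agree⇒⇔ : ∀ F G f {i j} → Agree F G f i j → Graph._~_ F i j ⇔ Graph._~_ G (f i) (f j)
agree⇒⇔ F G f {i} {j} a with Graph._~?_ F i j
... | yes p = mk⇔ (λ _ → a) (λ _ → p)
... | no ¬p = mk⇔ (λ p → contradiction p ¬p) (λ q → contradiction q a)

-- Only the pairs with `i` below `j` are asked for: symmetry and irreflexivity supply the others,
-- and injectivity follows from point-determination.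
agree⇒⊑ : ∀ F G (f : Vertex F → Vertex G) → PointDetermining F →
          (∀ j (i : Fin′ j) → Agree F G f (inject i) j) → F ⊑ G
agree⇒⊑ F G f pd agree = hom⇒⊑ F G pd hom
  where
  module F = Graph F
  module G = Graph G

  upper : ∀ {i j} → toℕ i < toℕ j → i F.~ j ⇔ f i G.~ f j
  upper {i} {j} i<j = subst (λ i → i F.~ j ⇔ f i G.~ f j)
    (Fin.toℕ-injective (trans (Fin.toℕ-inject {i = j} (fromℕ< i<j)) (Fin.toℕ-fromℕ< i<j)))
    (agree⇒⇔ F G f (agree j (fromℕ< i<j)))

  hom : IsFullHom F G f
  hom i j with Fin.<-cmp i j
  ... | tri< i<j _ _  = upper i<j
  ... | tri≈ _ refl _ = mk⇔ (λ r → contradiction r (F.irrefl refl)) (λ r → contradiction r (G.irrefl refl))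
  ... | tri> _ _ j<i  = ⇔.trans (mk⇔ F.symm F.symm) (⇔.trans (upper j<i) (mk⇔ G.symm G.symm))

SameAdjacency : (F G : Graph) → (Vertex F → Vertex G) → Set
SameAdjacency F G f = ∀ i j → does (Graph._~?_ F i j) ≡ does (Graph._~?_ G (f i) (f j))

sameAdjacency? : ∀ F G f → Dec (SameAdjacency F G f)
sameAdjacency? F G f = Fin.all? λ i → Fin.all? λ j →
  does (Graph._~?_ F i j) Bool.≟ does (Graph._~?_ G (f i) (f j))

sameAdjacency⇒⊑ : ∀ F G f → PointDetermining F → SameAdjacency F G f → F ⊑ G
sameAdjacency⇒⊑ F G f pd same = hom⇒⊑ F G pd λ i j →
  does-⇔ (Graph._~?_ F i j) (Graph._~?_ G (f i) (f j)) (same i j)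

-- The following three proper induced subgraphs account for the bounds in O.

K₁+P₄⊑A : LF₂-graph 0 1 ⊑ A
K₁+P₄⊑A = sameAdjacency⇒⊑ (LF₂-graph 0 1) A f
  (distinguished⇒pointDetermining (LF₂-graph 0 1) (from-yes (isPointDetermining? (LF₂-graph 0 1))))
  (from-yes (sameAdjacency? (LF₂-graph 0 1) A f))
  where f = lookup (0F ∷ 2F ∷ 3F ∷ 4F ∷ 5F ∷ [])

P₅⊑B : P 5 ⊑ B
P₅⊑B = sameAdjacency⇒⊑ (P 5) B f (P-pointDetermining λ ()) (from-yes (sameAdjacency? (P 5) B f))
  where f = lookup (0F ∷ 5F ∷ 4F ∷ 3F ∷ 2F ∷ [])

K₁+2K₂⊑E : LF₂-graph 2 0 ⊑ E
K₁+2K₂⊑E = sameAdjacency⇒⊑ (LF₂-graph 2 0) E f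
  (distinguished⇒pointDetermining (LF₂-graph 2 0) (from-yes (isPointDetermining? (LF₂-graph 2 0))))
  (from-yes (sameAdjacency? (LF₂-graph 2 0) E f))
  where f = lookup (4F ∷ 0F ∷ 5F ∷ 2F ∷ 3F ∷ [])

-- Paths in graphs of maximum degree two.

MaxDegree≤2 : Graph → Set
MaxDegree≤2 G = ∀ {c x y z} → c ~ x → c ~ y → c ~ z → x ≢ y → y ≢ z → x ≢ z → ⊥
  where open Graph G

-- Walks are sequences that are constant from their last vertex p l on, so that
-- HeadEnd also covers the case l = 0.
record Path (G : Graph) (S : Pred (Vertex G) 0ℓ) (l : ℕ) (p : ℕ → Vertex G) : Set where
  open Graph G
  field
    inside   : ∀ i → S (p i)
    distinct : ∀ {i j} → i ≤ l → j ≤ l → p i ≡ p j → i ≡ j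
    edge     : ∀ {i} → i < l → p i ~ p (suc i)
    constant : p (suc l) ≡ p l

HeadEnd : (G : Graph) → (ℕ → Vertex G) → Set
HeadEnd G p = ∀ y → p 0 ~ y → y ≡ p 1
  where open Graph G

module Walks (G : Graph) (deg : MaxDegree≤2 G) where

  open Graph G using (_~_; _~?_; symm; irrefl)

  path-≤ : ∀ {S l p} → Path G S l p → suc l ≤ order G
  path-≤ {l = l} {p} π = Fin.injective⇒≤ {f = p ∘ toℕ} λ {x} {y} eq →
    Fin.toℕ-injective (distinct (ℕ.≤-pred (Fin.toℕ<n x)) (ℕ.≤-pred (Fin.toℕ<n y)) eq)
    where open Path π

  module _ {l : ℕ} {p : ℕ → Vertex G} {S : Pred (Vertex G) 0ℓ} (π : Path G S l p) (2≤l : 2 ≤ l) (closing : p 0 ~ p l) where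

    open Path π

    around : Fin (suc l) → Vertex G
    around = p ∘ toℕ

    around-injective : Injective _≡_ _≡_ around
    around-injective {x} {y} eq =
      Fin.toℕ-injective (distinct (ℕ.≤-pred (Fin.toℕ<n x)) (ℕ.≤-pred (Fin.toℕ<n y)) eq)

    around-next : ∀ x → around x ~ around (next x)
    around-next x with arc-next x
    ... | inj₁ eq = subst (λ i → around x ~ p i) (sym eq)
      (edge (ℕ.≤-pred (subst (_< suc l) eq (Fin.toℕ<n (next x)))))
    ... | inj₂ (last , first) = subst₂ (λ i j → p i ~ p j) (sym (ℕ.suc-injective last)) (sym first) (symm closing)

    around-prev : ∀ x → around x ~ around (prev x)
    around-prev x = symm (subst (λ y → around (prev x) ~ around y) (next-prev x) (around-next (prev x)))

    -- Since `m` is at least 3, `next x` and `prev x` give two distinct neighbours, which exhaust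
    -- the degree. So the cycle is induced and no edge leaves it.
    around-closed : ∀ x {y} → around x ~ y → y ≡ around (next x) ⊎ y ≡ around (prev x)
    around-closed x {y} r with y Fin.≟ around (next x) | y Fin.≟ around (prev x)
    ... | yes eq | _      = inj₁ eq
    ... | no  _  | yes eq = inj₂ eq
    ... | no ≢₁  | no ≢₂  = ⊥-elim (deg (around-next x) (around-prev x) r
      (λ eq → no-short-period 2 (prev x) z<s (s≤s 2≤l)
                (trans (cong next (next-prev x)) (around-injective eq)))
      (≢₂ ∘ sym) (≢₁ ∘ sym))

    cycle-⊑ : C (suc l) ⊑ G
    cycle-⊑ = emb (record { to = around ; injective = around-injective ; full = λ x y → mk⇔ (to′ x y) (from′ x y) })
      where
      2≤m : 2 ≤ suc l
      2≤m = ℕ.≤-trans 2≤l (ℕ.n≤1+n l)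

      to′ : ∀ x y → Graph._~_ (C (suc l)) x y → around x ~ around y
      to′ x y r with ~⇒next {x = x} {y} r
      ... | inj₁ refl = around-next x
      ... | inj₂ refl = symm (around-next y)

      from′ : ∀ x y → around x ~ around y → Graph._~_ (C (suc l)) x y
      from′ x y r with around-closed x r
      ... | inj₁ eq = subst (Graph._~_ (C (suc l)) x) (sym (around-injective eq)) (~-next 2≤m x)
      ... | inj₂ eq = Graph.symm (C (suc l))
        (subst (λ z → Graph._~_ (C (suc l)) z x) (sym (around-injective eq)) (~-prev 2≤m x))

  module _ (S : Pred (Vertex G) 0ℓ) (S-closed : ∀ {x y} → S x → x ~ y → S y) where

    Cyclic : Set
    Cyclic = ∃[ l ] ∃[ p ] Path G S l p × 2 ≤ l × p 0 ~ p l

    infixr 5 _◂_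
    _◂_ : Vertex G → (ℕ → Vertex G) → ℕ → Vertex G
    (y ◂ p) zero    = y
    (y ◂ p) (suc i) = p i

    trivial-path : ∀ {v} → S v → Path G S 0 (λ _ → v)
    trivial-path Sv = record
      { inside = λ _ → Sv ; distinct = λ { z≤n z≤n _ → refl } ; edge = λ () ; constant = refl }

    ◂-path : ∀ {l p y} → Path G S l p → p 0 ~ y → (∀ {i} → i ≤ l → p i ≢ y) → Path G S (suc l) (y ◂ p)
    ◂-path {l} {p} {y} π r fresh = record
      { inside   = λ { zero → S-closed (inside 0) r ; (suc i) → inside i }
      ; distinct = fresh-distinct
      ; edge     = λ { {zero} _ → symm r ; {suc i} (s≤s i<l) → edge i<l }
      ; constant = constant
      }
      where
      open Path π

      fresh-distinct : ∀ {i j} → i ≤ suc l → j ≤ suc l → (y ◂ p) i ≡ (y ◂ p) j → i ≡ j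
      fresh-distinct {zero}  {zero}  _ _ _ = refl
      fresh-distinct {zero}  {suc j} _ (s≤s j≤l) eq = contradiction (sym eq) (fresh j≤l)
      fresh-distinct {suc i} {zero}  (s≤s i≤l) _ eq = contradiction eq (fresh i≤l)
      fresh-distinct {suc i} {suc j} (s≤s i≤l) (s≤s j≤l) eq = cong suc (distinct i≤l j≤l eq)

    Grown : Vertex G → Set
    Grown end = ∃[ l ] ∃[ p ] Path G S l p × HeadEnd G p × p l ≡ end

    -- The path is prolonged at its head only, so the tail `p l` stays fixed; `path-≤` bounds its
    -- length. A head neighbour other than `p 1` that is already on the path can only be the tail,
    -- and then a cycle closes.
    grow : ∀ fuel {l p} → order G ≤ fuel + suc l → Path G S l p → Cyclic ⊎ Grown (p l)
    grow fuel {l} {p} enough π with Fin.any? (λ y → (p 0 ~? y) ×-dec ¬? (y Fin.≟ p 1))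
    ... | no stuck = inj₂ (l , p , π , head-end , refl)
      where
      head-end : HeadEnd G p
      head-end y r with y Fin.≟ p 1
      ... | yes eq = eq
      ... | no  ≢₁ = contradiction (y , r , ≢₁) stuck
    ... | yes (y , r , y≢p1) with Fin.any? (λ (i : Fin (suc l)) → p (toℕ i) Fin.≟ y)
    ...   | no fresh = extend fuel enough
      where
      π′ : Path G S (suc l) (y ◂ p)
      π′ = ◂-path π r λ {i} i≤l eq → fresh (fromℕ< (s≤s i≤l) , trans (cong p (Fin.toℕ-fromℕ< (s≤s i≤l))) eq)

      extend : ∀ fuel → order G ≤ fuel + suc l → Cyclic ⊎ Grown (p l)
      extend zero       enough = contradiction (ℕ.≤-trans (path-≤ π′) enough) ℕ.1+n≰n
      extend (suc fuel) enough = grow fuel (subst (order G ≤_) (sym (ℕ.+-suc fuel (suc l))) enough) π′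
    ...   | yes (i , pi≡y) = inj₁ (revisit (toℕ i) (ℕ.≤-pred (Fin.toℕ<n i)) pi≡y)
      where
      open Path π

      revisit : ∀ i → i ≤ l → p i ≡ y → Cyclic
      revisit zero          _   eq = contradiction r (irrefl eq)
      revisit (suc zero)    _   eq = contradiction (sym eq) y≢p1
      revisit (suc (suc i)) i≤l refl with ℕ.m≤n⇒m<n∨m≡n i≤l
      ... | inj₂ refl = l , p , π , s≤s (s≤s z≤n) , r
      -- An inner vertex would have its two neighbours on the path and `p 0` as three distinct
      -- neighbours.
      ... | inj₁ i<l  = ⊥-elim (deg (symm (edge i≤l)) (edge i<l) (symm r)
        (λ eq → ℕ.<⇒≢ (ℕ.≤-trans (ℕ.n<1+n _) (ℕ.n≤1+n _)) (distinct (ℕ.≤-trans (ℕ.n≤1+n _) i≤l) i<l eq))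
        (λ eq → contradiction (distinct i<l z≤n eq) λ ())
        (λ eq → contradiction (distinct (ℕ.≤-trans (ℕ.n≤1+n _) i≤l) z≤n eq) λ ()))

  module _ {S : Pred (Vertex G) 0ℓ} {l : ℕ} {p : ℕ → Vertex G} (π : Path G S l p)
           (head-end : HeadEnd G p) (tail-end : ∀ {y z} → p l ~ y → p l ~ z → y ≡ z) where

    open Path π

    -- Inner vertices have their degree used up by the path, and the end conditions settle the rest.
    -- So the path is induced and is a whole component.
    path-neighbours : ∀ i → i ≤ l → ∀ {y} → p i ~ y →
                      (i < l × p (suc i) ≡ y) ⊎ (∃[ k ] i ≡ suc k × p k ≡ y)
    path-neighbours zero 0≤l {y} r with ℕ.m≤n⇒m<n∨m≡n 0≤l
    ... | inj₁ 0<l  = inj₁ (0<l , sym (head-end y r))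
    -- For `l = 0` the vertex `p 1` is `p 0`, so `HeadEnd` would make `p 0` its own neighbour.
    ... | inj₂ refl = contradiction r (irrefl (sym (trans (head-end y r) constant)))
    path-neighbours (suc i) i<l {y} r with ℕ.m≤n⇒m<n∨m≡n i<l
    ... | inj₂ refl = inj₂ (i , refl , tail-end (symm (edge ℕ.≤-refl)) r)
    ... | inj₁ 1+i<l with p (suc (suc i)) Fin.≟ y | p i Fin.≟ y
    ...   | yes eq | _      = inj₁ (1+i<l , eq)
    ...   | no _   | yes eq = inj₂ (i , refl , eq)
    ...   | no ≢₁  | no ≢₂  = ⊥-elim (deg (edge 1+i<l) (symm (edge i<l)) r
      (λ eq → ℕ.<⇒≢ (ℕ.≤-trans (ℕ.n<1+n _) (ℕ.n≤1+n _)) (sym (distinct 1+i<l (ℕ.<⇒≤ i<l) eq))) ≢₂ ≢₁)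

    path-⊑ : P (suc l) ⊑ G
    path-⊑ = emb (record { to = p ∘ toℕ ; injective = inj ; full = λ x y → mk⇔ (to′ x y) (from′ x y) })
      where
      inj : Injective _≡_ _≡_ (p ∘ toℕ {suc l})
      inj {x} {y} eq =
        Fin.toℕ-injective (distinct (ℕ.≤-pred (Fin.toℕ<n x)) (ℕ.≤-pred (Fin.toℕ<n y)) eq)

      up : ∀ (x y : Fin (suc l)) → toℕ y ≡ suc (toℕ x) → p (toℕ x) ~ p (toℕ y)
      up x y eq = subst (λ j → p (toℕ x) ~ p j) (sym eq)
        (edge (ℕ.≤-pred (subst (_< suc l) eq (Fin.toℕ<n y))))

      to′ : ∀ x y → Graph._~_ (P (suc l)) x y → p (toℕ x) ~ p (toℕ y)
      to′ x y (_ , inj₁ eq) = up x y eq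
      to′ x y (_ , inj₂ eq) = symm (up y x eq)

      from′ : ∀ x y → p (toℕ x) ~ p (toℕ y) → Graph._~_ (P (suc l)) x y
      from′ x y r with path-neighbours (toℕ x) (ℕ.≤-pred (Fin.toℕ<n x)) r
      ... | inj₁ (x<l , eq)     = P-edge (distinct (ℕ.≤-pred (Fin.toℕ<n y)) x<l (sym eq))
      ... | inj₂ (k , x≡1+k , eq) = Graph.symm (P (suc l)) (P-edge (trans x≡1+k
        (cong suc (distinct (ℕ.≤-trans (ℕ.n≤1+n k) (subst (_≤ l) x≡1+k (ℕ.≤-pred (Fin.toℕ<n x))))
                            (ℕ.≤-pred (Fin.toℕ<n y)) eq))))

    path-closed : ∀ (x : Fin (suc l)) {y} → p (toℕ x) ~ y → ∃[ z ] p (toℕ {suc l} z) ≡ y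
    path-closed x r with path-neighbours (toℕ x) (ℕ.≤-pred (Fin.toℕ<n x)) r
    ... | inj₁ (x<l , eq)       = fromℕ< (s≤s x<l) , trans (cong p (Fin.toℕ-fromℕ< (s≤s x<l))) eq
    ... | inj₂ (k , x≡1+k , eq) = let k<1+l = s≤s (ℕ.≤-trans (ℕ.n≤1+n k) (subst (_≤ l) x≡1+k (ℕ.≤-pred (Fin.toℕ<n x)))) in
      fromℕ< k<1+l , trans (cong p (Fin.toℕ-fromℕ< k<1+l)) eq

-- Linear forests.

P-translate : ∀ {a c} k (f : Fin a → Fin c) → (∀ i → toℕ (f i) ≡ k + toℕ i) → P a ⊑ P c
P-translate {a} {c} k f f≡ = emb (record { to = f ; injective = inj ; full = λ i j → mk⇔
  (λ (i≢j , r) → i≢j ∘ inj , Sum.map (up i j) (up j i) r)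
  (λ (fi≢fj , r) → fi≢fj ∘ cong f , Sum.map (down i j) (down j i) r) })
  where
  inj : Injective _≡_ _≡_ f
  inj {i} {j} eq = Fin.toℕ-injective (ℕ.+-cancelˡ-≡ k _ _ (trans (sym (f≡ i)) (trans (cong toℕ eq) (f≡ j))))

  up : ∀ i j → toℕ j ≡ suc (toℕ i) → toℕ (f j) ≡ suc (toℕ (f i))
  up i j eq = trans (f≡ j) (trans (cong (k +_) eq) (trans (ℕ.+-suc k _) (cong suc (sym (f≡ i)))))

  down : ∀ i j → toℕ (f j) ≡ suc (toℕ (f i)) → toℕ j ≡ suc (toℕ i)
  down i j eq = ℕ.+-cancelˡ-≡ k _ _ (trans (sym (f≡ j)) (trans eq (trans (cong suc (f≡ i)) (sym (ℕ.+-suc k _)))))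

P-mono : ∀ {a c} → a ≤ c → P a ⊑ P c
P-mono a≤c = P-translate 0 (λ i → inject≤ i a≤c) (λ i → Fin.toℕ-inject≤ i a≤c)

-- The vertex at position `a` is dropped. The order falls by one and the weight is unchanged, since
-- the dropped vertex turns into the extra unit of a second path.
P-split : ∀ a b → P a ⊕ P b ⊑ P (suc a + b)
P-split a b = ⊕-universal left right (λ i j eq → ≢ i j (cong toℕ eq)) λ where
    i j (_ , inj₁ eq) → ℕ.<⇒≢ (s≤s (ℕ.≤-trans (Fin.toℕ<n i) (ℕ.m≤m+n a (toℕ j))))
      (trans (cong suc (sym (Fin.toℕ-inject≤ i _))) (trans (sym eq) (Fin.toℕ-↑ʳ (suc a) j)))
    i j (_ , inj₂ eq) → ℕ.<⇒≢ (ℕ.<-trans (lt i j) (ℕ.n<1+n _))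
      (trans (sym (Fin.toℕ-inject≤ i _)) (trans eq (cong suc (Fin.toℕ-↑ʳ (suc a) j))))
  where
  left : P a ⊑ P (suc a + b)
  left = P-mono (ℕ.≤-trans (ℕ.n≤1+n a) (ℕ.m≤m+n (suc a) b))

  right : P b ⊑ P (suc a + b)
  right = P-translate (suc a) (suc a ↑ʳ_) (Fin.toℕ-↑ʳ (suc a))

  lt : ∀ (i : Fin a) (j : Fin b) → toℕ i < suc a + toℕ j
  lt i j = ℕ.<-trans (Fin.toℕ<n i) (s≤s (ℕ.m≤m+n a (toℕ j)))

  ≢ : ∀ i j → toℕ (to (rel left) i) ≢ toℕ (to (rel right) j)
  ≢ i j eq = ℕ.<⇒≢ (lt i j) (trans (sym (Fin.toℕ-inject≤ i _)) (trans eq (Fin.toℕ-↑ʳ (suc a) j)))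

forest : List ℕ → Graph
forest []      = K 0
forest (l ∷ L) = P l ⊕ forest L

weight : List ℕ → ℕ
weight []      = 0
weight (l ∷ L) = suc l + weight L

forest-∷ : ∀ {F l} L → F ⊑ P l → F ⊕ forest L ⊑ forest (l ∷ L)
forest-∷ L f = ⊕-mono f (⊑-refl {forest L})

forest-under : ∀ l L M → forest L ⊑ forest M → forest (l ∷ L) ⊑ forest (l ∷ M)
forest-under l L M f = ⊕-mono (⊑-refl {P l}) f

forest-split : ∀ a b L → forest (a ∷ b ∷ L) ⊑ forest (suc a + b ∷ L)
forest-split a b L = ⊑-trans (⊕-assocˡ (P a) (P b) (forest L)) (forest-∷ L (P-split a b))

forest-↭ : ∀ {L M} → L ↭ M → forest L ⊑ forest M
forest-↭ {L} ↭.refl = ⊑-refl {forest L}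
forest-↭ (↭.prep {L} {M} l p) = forest-under l L M (forest-↭ p)
forest-↭ (↭.swap {L} {M} k l p) = ⊑-trans (⊕-exchange (P k) (P l) (forest L))
  (forest-under l (k ∷ L) (k ∷ M) (forest-under k L M (forest-↭ p)))
forest-↭ (↭.trans p q) = ⊑-trans (forest-↭ p) (forest-↭ q)

obs-↭ : ∀ H L M → L ↭ M → obs H (forest L) → obs H (forest M)
obs-↭ H L M p = obs-≅ H (forest L) (forest M) (⊑⇒≅ (forest-↭ p) (⊑⇒≤ (forest-↭ (↭-sym p))))

extract : ∀ {l L} → l ∈ L → ∃[ M ] L ↭ l ∷ M
extract l∈L with ∈-∃++ l∈L
... | ys , zs , refl = ys ++ zs , ↭.shift _ ys zs

-- `P 1` is an isolated vertex and `P 3` has twin ends; all longer or intermediate paths can be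
-- combined without creating twins.
Good : Pred ℕ 0ℓ
Good l = 2 ≤ l × l ≢ 3

good⇒hasNoIsolated : ∀ {l} → Good l → HasNoIsolated (P l)
good⇒hasNoIsolated {suc (suc l)} _ = P-hasNoIsolated l
good⇒hasNoIsolated {suc zero} (s≤s () , _)

forest-hasNoIsolated : ∀ {L} → All Good L → HasNoIsolated (forest L)
forest-hasNoIsolated {l ∷ L} (g ∷ gs) = ⊕-hasNoIsolated (P l) (forest L) (good⇒hasNoIsolated g) (forest-hasNoIsolated gs)

forest-∷-pointDetermining : ∀ {l L} → l ≢ 3 → All Good L → PointDetermining (forest (l ∷ L))
forest-pointDetermining   : ∀ {L} → All Good L → PointDetermining (forest L)
forest-∷-pointDetermining {l} {L} l≢3 gs =
  ⊕-pointDetermining (P l) (forest L) (P-pointDetermining l≢3) (forest-pointDetermining gs) (forest-hasNoIsolated gs)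
forest-pointDetermining {l ∷ L} ((_ , l≢3) ∷ gs) = forest-∷-pointDetermining l≢3 gs

forest-layout : ∀ L → Layout ⊥ (weight L) (forest L) Everywhere
forest-layout []      = empty-layout
forest-layout (l ∷ L) = ⊕-layout {F = P l} {forest L} (P-layout l) (forest-layout L)

data Two∣Four∣Six : Pred ℕ 0ℓ where
  two  : Two∣Four∣Six 2
  four : Two∣Four∣Six 4
  six  : Two∣Four∣Six 6

K₂⊑P₂ : K 2 ⊑ P 2
K₂⊑P₂ = sameAdjacency⇒⊑ (K 2) (P 2) id K₂-pointDetermining (from-yes (sameAdjacency? (K 2) (P 2) id))

⊕-pullˡ : ∀ {F F′ G} H → F ⊑ G ⊕ F′ → F ⊕ H ⊑ G ⊕ (F′ ⊕ H)
⊕-pullˡ {F} {F′} {G} H f = ⊑-trans (⊕-mono f (⊑-refl {H})) (⊕-assocʳ G F′ H)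

⊕-pullʳ : ∀ {F F′ G} H → F ⊑ G ⊕ F′ → H ⊕ F ⊑ G ⊕ (H ⊕ F′)
⊕-pullʳ {F} {F′} {G} H f = ⊑-trans (⊕-mono (⊑-refl {H}) f) (⊕-exchange H G F′)

twos : ∀ {L} → All (_≡ 2) L → ∃[ m₂ ] 3 * m₂ ≡ weight L × m₂ · K 2 ⊑ forest L
twos []              = 0 , refl , ⊑-refl
twos {_ ∷ L} (refl ∷ ts) with twos ts
... | m₂ , eq , f = suc m₂ , trans (count m₂) (cong (3 +_) eq) , ⊕-mono K₂⊑P₂ f
  where
  count : ∀ a → 3 * suc a ≡ 3 + 3 * a
  count = solve-∀

-- The alternative on `m₆` is recorded because a component `P 6` lowers the admissible weight, which
-- is what separates `LF₃` from `LF₂`.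
sort : ∀ {L} → All Two∣Four∣Six L → ∃[ m₂ ] ∃[ m₄ ] ∃[ m₆ ]
       3 * m₂ + 5 * m₄ + 7 * m₆ ≡ weight L × (m₆ ≡ 0 ⊎ 6 ∈ L) × LF₃-graph m₂ m₄ m₆ ⊑ forest (1 ∷ L)
sort [] = 0 , 0 , 0 , refl , inj₁ refl , sameAdjacency⇒⊑ (LF₃-graph 0 0 0) (forest (1 ∷ [])) id (λ { 0F 0F _ → refl }) (λ { 0F 0F → refl })
sort {l ∷ L} (t ∷ ts) with sort ts
... | m₂ , m₄ , m₆ , eq , no-6 , f = insert t
  where
  under : ∀ {F} → F ⊑ P l ⊕ LF₃-graph m₂ m₄ m₆ → F ⊑ forest (1 ∷ l ∷ L)
  under g = ⊑-trans g (⊑-trans (⊕-mono (⊑-refl {P l}) f) (⊕-exchange (P l) (P 1) (forest L)))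

  add₂ : ∀ a b c → 3 * suc a + 5 * b + 7 * c ≡ 3 + (3 * a + 5 * b + 7 * c)
  add₂ = solve-∀
  add₄ : ∀ a b c → 3 * a + 5 * suc b + 7 * c ≡ 5 + (3 * a + 5 * b + 7 * c)
  add₄ = solve-∀
  add₆ : ∀ a b c → 3 * a + 5 * b + 7 * suc c ≡ 7 + (3 * a + 5 * b + 7 * c)
  add₆ = solve-∀

  insert : Two∣Four∣Six l → ∃[ m₂ ] ∃[ m₄ ] ∃[ m₆ ]
           3 * m₂ + 5 * m₄ + 7 * m₆ ≡ weight (l ∷ L) × (m₆ ≡ 0 ⊎ 6 ∈ l ∷ L) × LF₃-graph m₂ m₄ m₆ ⊑ forest (1 ∷ l ∷ L)
  insert two  = suc m₂ , m₄ , m₆ , trans (add₂ m₂ m₄ m₆) (cong (3 +_) eq) , Sum.map₂ there no-6 ,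
    under (⊕-pullˡ {F′ = LF₂-graph m₂ m₄} {P 2} (m₆ · P 6) (⊕-pullˡ {F′ = K 1 ⊕ m₂ · K 2} {P 2} (m₄ · P 4)
      (⊕-pullʳ {F′ = m₂ · K 2} {P 2} (K 1) (⊕-mono K₂⊑P₂ (⊑-refl {m₂ · K 2})))))
  insert four = m₂ , suc m₄ , m₆ , trans (add₄ m₂ m₄ m₆) (cong (5 +_) eq) , Sum.map₂ there no-6 ,
    under (⊕-pullˡ {F′ = LF₂-graph m₂ m₄} {P 4} (m₆ · P 6) (⊕-pullʳ {F′ = m₄ · P 4} {P 4} (K 1 ⊕ m₂ · K 2)
      (⊑-refl {suc m₄ · P 4})))
  insert six  = m₂ , m₄ , suc m₆ , trans (add₆ m₂ m₄ m₆) (cong (7 +_) eq) , inj₂ (here refl) ,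
    under (⊕-pullʳ {F′ = m₆ · P 6} {P 6} (LF₂-graph m₂ m₄) (⊑-refl {suc m₆ · P 6}))

-- Weights and components of forests that are minimal obstructions.

module _ {n : ℕ} (3≤n : 3 ≤ n) where

  private
    2≤n = ℕ.≤-trans (ℕ.n≤1+n 2) 3≤n
    1≤n = ℕ.≤-trans (ℕ.n≤1+n 1) 2≤n

  forest-thick : ∀ {L} → All (1 ≤_) L → Thick n (weight L) (forest L)
  forest-thick []                  = empty-thick
  forest-thick {suc l ∷ L} (_ ∷ ps) = ⊕-thick {F = P (suc l)} {forest L} 2≤n (P-thick 3≤n l) (forest-thick ps)

  good⇒positive : ∀ {L} → All Good L → All (1 ≤_) L
  good⇒positive = All.map λ (2≤l , _) → ℕ.≤-trans (ℕ.n≤1+n 1) 2≤l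

  forest-noncolourable : ∀ {L} → All Good L → n < weight L → ¬ FullColouring (C n) (forest L)
  forest-noncolourable {L} gs =
    thick-noncolourable {G = forest L} (forest-pointDetermining gs) (forest-thick (good⇒positive gs))

  rooted-noncolourable : ∀ {L} → All Good L → n < 2 + weight L → ¬ FullColouring (C n) (forest (1 ∷ L))
  rooted-noncolourable {L} gs = thick-noncolourable {G = forest (1 ∷ L)}
    (forest-∷-pointDetermining (λ ()) gs) (forest-thick (s≤s z≤n ∷ good⇒positive gs))

  obs⇒heavy : ∀ L → obs (C n) (forest L) → n < weight L
  obs⇒heavy L (¬col , _) = ℕ.≰⇒> λ w≤n → ¬col (layout⇒colouring {G = forest L} w≤n 1≤n (forest-layout L))

  -- A proper subforest without twins and of weight above `n` would itself be noncolourable. With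
  -- `obs⇒heavy` this forbids any such subforest of the same weight as the obstruction.
  obs⇒lighter : ∀ L M → obs (C n) (forest L) → All Good M →
                forest M ⊑ forest L → order (forest M) < order (forest L) → weight M ≤ n
  obs⇒lighter L M o gs f M<L = ℕ.≮⇒≥ λ n<w →
    forest-noncolourable gs n<w (proper-colour (C n) o f M<L)

  obs⇒rooted-lighter : ∀ L M → obs (C n) (forest L) → All Good M →
                       forest (1 ∷ M) ⊑ forest L → order (forest (1 ∷ M)) < order (forest L) → weight (1 ∷ M) ≤ n
  obs⇒rooted-lighter L M o gs f M<L = ℕ.≮⇒≥ λ n<w →
    rooted-noncolourable gs n<w (proper-colour (C n) o f M<L)

  private
    good-2 : Good 2
    good-2 = ℕ.≤-refl , λ ()

    good-4+ : ∀ l → Good (4 + l)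
    good-4+ l = s≤s (s≤s z≤n) , λ ()

  -- Every other good order splits at equal weight without creating twins: 4 into 1 and 2, 5 into 2
  -- and 2 (1 and 3 would leave a `P 3`), and 6 + l into 1 and 4 + l.
  unrooted-component : ∀ l L → Good l → All Good L → obs (C n) (forest (l ∷ L)) → l ≡ 2
  unrooted-component 1 L (s≤s () , _) _ _
  unrooted-component 2 L _ _ _ = refl
  unrooted-component 3 L (_ , 3≢3) _ _ = contradiction refl 3≢3
  unrooted-component 4 L _ gs o = contradiction (obs⇒heavy (4 ∷ L) o)
    (ℕ.≤⇒≯ (obs⇒rooted-lighter (4 ∷ L) (2 ∷ L) o (good-2 ∷ gs) (forest-split 1 2 L) ℕ.≤-refl))
  unrooted-component 5 L _ gs o = contradiction (obs⇒heavy (5 ∷ L) o)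
    (ℕ.≤⇒≯ (obs⇒lighter (5 ∷ L) (2 ∷ 2 ∷ L) o (good-2 ∷ good-2 ∷ gs) (forest-split 2 2 L) ℕ.≤-refl))
  unrooted-component (suc (suc (suc (suc (suc (suc l)))))) L _ gs o = contradiction (obs⇒heavy (6 + l ∷ L) o)
    (ℕ.≤⇒≯ (obs⇒rooted-lighter (6 + l ∷ L) (4 + l ∷ L) o (good-4+ l ∷ gs) (forest-split 1 (4 + l) L) ℕ.≤-refl))

  -- A second `P 1` would be a twin of the root, so only `P 2` is split off. Among the good orders
  -- above 2 this fails just for 4, where it leaves `P 1`, and for 6, where it leaves `P 3`.
  rooted-component : ∀ l L → Good l → All Good L → obs (C n) (forest (1 ∷ l ∷ L)) → Two∣Four∣Six l
  rooted-component 1 L (s≤s () , _) _ _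
  rooted-component 2 L _ _ _ = two
  rooted-component 3 L (_ , 3≢3) _ _ = contradiction refl 3≢3
  rooted-component 4 L _ _ _ = four
  rooted-component 5 L _ gs o = contradiction (obs⇒heavy (1 ∷ 5 ∷ L) o)
    (ℕ.≤⇒≯ (obs⇒rooted-lighter (1 ∷ 5 ∷ L) (2 ∷ 2 ∷ L) o (good-2 ∷ good-2 ∷ gs)
      (forest-under 1 (2 ∷ 2 ∷ L) (5 ∷ L) (forest-split 2 2 L)) ℕ.≤-refl))
  rooted-component 6 L _ _ _ = six
  rooted-component (suc (suc (suc (suc (suc (suc (suc l))))))) L _ gs o = contradiction (obs⇒heavy (1 ∷ 7 + l ∷ L) o)
    (ℕ.≤⇒≯ (obs⇒rooted-lighter (1 ∷ 7 + l ∷ L) (2 ∷ 4 + l ∷ L) o (good-2 ∷ good-4+ l ∷ gs)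
      (forest-under 1 (2 ∷ 4 + l ∷ L) (7 + l ∷ L) (forest-split 2 (4 + l) L)) ℕ.≤-refl))

  -- Cutting an end off `P 6` leaves the good path `P 5` and loses one unit of weight. For `P 4` the
  -- same cut would leave `P 3`.
  sixth-component : ∀ L → All Good L → obs (C n) (forest (1 ∷ 6 ∷ L)) → weight (1 ∷ 6 ∷ L) ≤ suc n
  sixth-component L gs o = s≤s (obs⇒rooted-lighter (1 ∷ 6 ∷ L) (5 ∷ L) o (good-4+ 1 ∷ gs)
    (forest-under 1 (5 ∷ L) (6 ∷ L) (forest-∷ L (P-mono (ℕ.n≤1+n 5)))) ℕ.≤-refl)

P₃-twins : ∀ z → Graph._~_ (P 3) z 0F ⇔ Graph._~_ (P 3) z 2F
P₃-twins 0F = does-⇔ (Graph._~?_ (P 3) 0F 0F) (Graph._~?_ (P 3) 0F 2F) refl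
P₃-twins 1F = does-⇔ (Graph._~?_ (P 3) 1F 0F) (Graph._~?_ (P 3) 1F 2F) refl
P₃-twins 2F = does-⇔ (Graph._~?_ (P 3) 2F 0F) (Graph._~?_ (P 3) 2F 2F) refl

no-P₃ : ∀ L → ¬ PointDetermining (forest (3 ∷ L))
no-P₃ L pd with pd 0F 2F (λ z → twins (splitAt 3 z))
  where
  twins : ∀ s → Pointwise (Graph._~_ (P 3)) (Graph._~_ (forest L)) s (inj₁ 0F) ⇔
                Pointwise (Graph._~_ (P 3)) (Graph._~_ (forest L)) s (inj₁ 2F)
  twins (inj₁ z) = mk⇔ (λ { (inj₁ r) → inj₁ (Equivalence.to (P₃-twins z) r) })
                       (λ { (inj₁ r) → inj₁ (Equivalence.from (P₃-twins z) r) })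
  twins (inj₂ z) = mk⇔ (λ ()) (λ ())
... | ()

no-2P₁ : ∀ L → ¬ PointDetermining (forest (1 ∷ 1 ∷ L))
no-2P₁ L pd with pd 0F 1F (λ z → twins (splitAt 1 z))
  where
  isolated : ∀ s → ¬ Pointwise (Graph._~_ (P 1)) (Graph._~_ (forest L)) s (inj₁ 0F)
  isolated (inj₁ 0F) (inj₁ (0≢0 , _)) = 0≢0 refl

  twins : ∀ s → Pointwise (Graph._~_ (P 1)) (Graph._~_ (forest (1 ∷ L))) s (inj₁ 0F) ⇔
                Pointwise (Graph._~_ (P 1)) (Graph._~_ (forest (1 ∷ L))) s (inj₂ 0F)
  twins (inj₁ 0F) = mk⇔ (λ { (inj₁ (0≢0 , _)) → contradiction refl 0≢0 }) (λ ())
  twins (inj₂ z)  = mk⇔ (λ ()) (λ { (inj₂ r) → contradiction r (isolated (splitAt 1 z)) })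
... | ()

weight-↭ : ∀ {L M} → L ↭ M → weight L ≡ weight M
weight-↭ ↭.refl                  = refl
weight-↭ (↭.prep l p)            = cong (suc l +_) (weight-↭ p)
weight-↭ (↭.swap {L} {M} k l p)  = trans (swap-+ (suc k) (suc l) (weight L)) (cong (λ w → suc l + (suc k + w)) (weight-↭ p))
  where
  swap-+ : ∀ a b c → a + (b + c) ≡ b + (a + c)
  swap-+ = solve-∀
weight-↭ (↭.trans p q)           = trans (weight-↭ p) (weight-↭ q)

all-good : ∀ {L} → All (1 ≤_) L → 3 ∉ L → 1 ∉ L → All Good L
all-good {L} ps 3∉L 1∉L = All.tabulate λ {l} l∈L →
  ℕ.≤∧≢⇒< (All.lookup ps l∈L) (λ { refl → 1∉L l∈L }) , λ { refl → 3∉L l∈L }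

module _ {n : ℕ} (3≤n : 3 ≤ suc n) where

  private
    Cₙ = C (suc n)

  unrooted-forest : ∀ L → All Good L → obs Cₙ (forest L) → ∃[ F ] LF n F × F ⊑ forest L
  unrooted-forest L gs o with twos all-2
    where
    all-2 : All (_≡ 2) L
    all-2 = All.tabulate λ {l} l∈L → let M , p = extract l∈L in
      unrooted-component 3≤n l M (All.lookup gs l∈L) (All.tail (All-resp-↭ p gs)) (obs-↭ Cₙ L (l ∷ M) p o)
  ... | m₂ , eq , f = m₂ · K 2 , inj₁ (lf₁ m₂ (trans eq (trans (tight L gs o) (ℕ.+-comm 2 n)))) , f
    where
    -- Cutting one `P 2` down to `P 1` loses one unit and creates no twins, so the weight exceeds
    -- the length of the cycle by exactly one.
    tight : ∀ L → All Good L → obs Cₙ (forest L) → weight L ≡ 2 + n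
    tight [] _ o = contradiction (obs⇒heavy 3≤n [] o) λ ()
    tight (l ∷ L) (g ∷ gs) o with unrooted-component 3≤n l L g gs o
    ... | refl = ℕ.≤-antisym
      (s≤s (obs⇒rooted-lighter 3≤n (2 ∷ L) L o gs (forest-∷ L (P-mono (ℕ.n≤1+n 1))) ℕ.≤-refl))
      (obs⇒heavy 3≤n (2 ∷ L) o)

  -- Removing the root loses two units, so the total weight `2 + weight L` exceeds the cycle length
  -- `suc n` by one or two.
  rooted-weight : ∀ L → All Good L → obs Cₙ (forest (1 ∷ L)) → weight L ≡ n ⊎ weight L ≡ suc n
  rooted-weight L gs o with weight L ℕ.≟ n
  ... | yes w≡n = inj₁ w≡n
  ... | no  w≢n = inj₂ (ℕ.≤-antisym
    (obs⇒lighter 3≤n (1 ∷ L) L o gs (⊑-⊕ʳ (P 1) (forest L)) ℕ.≤-refl)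
    (ℕ.≤∧≢⇒< (ℕ.≤-pred (ℕ.≤-pred (obs⇒heavy 3≤n (1 ∷ L) o))) (w≢n ∘ sym)))

  rooted-246 : ∀ L → All Good L → obs Cₙ (forest (1 ∷ L)) → All Two∣Four∣Six L
  rooted-246 L gs o = All.tabulate λ {l} l∈L → let M , p = extract l∈L in
    rooted-component 3≤n l M (All.lookup gs l∈L) (All.tail (All-resp-↭ p gs))
      (obs-↭ Cₙ (1 ∷ L) (1 ∷ l ∷ M) (↭.prep 1 p) o)

  rooted-6 : ∀ L → All Good L → obs Cₙ (forest (1 ∷ L)) → 6 ∈ L → weight L ≤ n
  rooted-6 L gs o 6∈L with extract 6∈L
  ... | M , p = subst (_≤ n) (weight-↭ (↭-sym p)) (ℕ.≤-pred (ℕ.≤-pred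
    (sixth-component 3≤n M (All.tail (All-resp-↭ p gs)) (obs-↭ Cₙ (1 ∷ L) (1 ∷ 6 ∷ M) (↭.prep 1 p) o))))

  rooted-forest : ∀ L → All Good L → obs Cₙ (forest (1 ∷ L)) → ∃[ F ] LF n F × F ⊑ forest (1 ∷ L)
  rooted-forest L gs o = finish (sort (rooted-246 L gs o)) (rooted-weight L gs o)
    where
    finish : (∃[ m₂ ] ∃[ m₄ ] ∃[ m₆ ] 3 * m₂ + 5 * m₄ + 7 * m₆ ≡ weight L × (m₆ ≡ 0 ⊎ 6 ∈ L) ×
                                      LF₃-graph m₂ m₄ m₆ ⊑ forest (1 ∷ L)) →
             weight L ≡ n ⊎ weight L ≡ suc n → ∃[ F ] LF n F × F ⊑ forest (1 ∷ L)
    finish (m₂ , m₄ , m₆ , eq , _ , f) (inj₁ w≡n) =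
      LF₃-graph m₂ m₄ m₆ , inj₂ (inj₂ (lf₃ m₂ m₄ m₆ (trans eq w≡n))) , f
    finish (m₂ , m₄ , _ , eq , inj₁ refl , f) (inj₂ w≡1+n) =
      LF₂-graph m₂ m₄ ,
      inj₂ (inj₁ (lf₂ m₂ m₄ (trans (sym (ℕ.+-identityʳ _)) (trans eq (trans w≡1+n (ℕ.+-comm 1 n)))))) ,
      ⊑-trans (⊑-⊕ˡ (LF₂-graph m₂ m₄) (K 0)) f
    finish (_ , _ , _ , _ , inj₂ 6∈L , _) (inj₂ w≡1+n) =
      contradiction (subst (_≤ n) w≡1+n (rooted-6 L gs o 6∈L)) ℕ.1+n≰n

  obs⇒3∉ : ∀ L → obs Cₙ (forest L) → 3 ∉ L
  obs⇒3∉ L o 3∈L = let M , p = extract 3∈L in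
    no-P₃ M (obs⇒PointDetermining Cₙ (forest (3 ∷ M)) (obs-↭ Cₙ L (3 ∷ M) p o))

  obs⇒1∉ : ∀ L → obs Cₙ (forest (1 ∷ L)) → 1 ∉ L
  obs⇒1∉ L o 1∈L = let M , p = extract 1∈L in
    no-2P₁ M (obs⇒PointDetermining Cₙ (forest (1 ∷ 1 ∷ M)) (obs-↭ Cₙ (1 ∷ L) (1 ∷ 1 ∷ M) (↭.prep 1 p) o))

  obs-forest : ∀ L → All (1 ≤_) L → obs Cₙ (forest L) → ∃[ F ] LF n F × F ⊑ forest L
  obs-forest L ps o = split (1 ∈? L)
    where
    rooted : ∀ M → L ↭ 1 ∷ M → ∃[ F ] LF n F × F ⊑ forest L
    rooted M p =
      let o′ = obs-↭ Cₙ L (1 ∷ M) p o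
          F , F∈LF , f = rooted-forest M
            (all-good (All.tail (All-resp-↭ p ps)) (obs⇒3∉ (1 ∷ M) o′ ∘ there) (obs⇒1∉ M o′)) o′
      in F , F∈LF , ⊑-trans f (forest-↭ (↭-sym p))

    split : Dec (1 ∈ L) → ∃[ F ] LF n F × F ⊑ forest L
    split (yes 1∈L) = let M , p = extract 1∈L in rooted M p
    split (no  1∉L) = unrooted-forest L (all-good ps (obs⇒3∉ L o) 1∉L) o

-- Every minimal obstruction is listed.

P-⊑-C : ∀ {l m} → l < m → P l ⊑ C m
P-⊑-C {l} {m} l<m = emb (record { to = ι ; injective = inj ; full = λ i j → mk⇔
  (λ (i≢j , r) → i≢j ∘ inj , Sum.map (up i j) (up j i) r)
  (λ (ιi≢ιj , r) → ιi≢ιj ∘ cong ι , Sum.map (down i j) (down j i) r) })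
  where
  ι : Fin l → Fin m
  ι i = inject≤ i (ℕ.<⇒≤ l<m)

  ι≡ : ∀ i → toℕ (ι i) ≡ toℕ i
  ι≡ i = Fin.toℕ-inject≤ i _

  inj : Injective _≡_ _≡_ ι
  inj {i} {j} eq = Fin.toℕ-injective (trans (sym (ι≡ i)) (trans (cong toℕ eq) (ι≡ j)))

  up : ∀ i j → toℕ j ≡ suc (toℕ i) → Arc m (ι i) (ι j)
  up i j eq = inj₁ (trans (ι≡ j) (trans eq (cong suc (sym (ι≡ i)))))

  down : ∀ i j → Arc m (ι i) (ι j) → toℕ j ≡ suc (toℕ i)
  down i j (inj₁ eq)       = trans (sym (ι≡ j)) (trans eq (cong suc (ι≡ i)))
  down i j (inj₂ (eq , _)) = contradiction (trans (cong suc (sym (ι≡ i))) eq)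
    (ℕ.<⇒≢ (ℕ.≤-<-trans (Fin.toℕ<n i) l<m))

module Obstruction (k : ℕ) (5≤n : 5 ≤ 2 + k) (G : Graph) (G∈obs : obs (C (2 + k)) G) where

  open Graph G using (_~_; _~?_; symm; irrefl)

  n : ℕ
  n = 2 + k

  3≤n : 3 ≤ n
  3≤n = ℕ.≤-trans (s≤s (s≤s (s≤s z≤n))) 5≤n

  2≤n : 2 ≤ n
  2≤n = s≤s (s≤s z≤n)

  Family : Pred Graph 0ℓ
  Family = CycleFamily k ∪ LF (suc k) ∪ O (suc k)

  Listed : Set₁
  Listed = UpToIso Family G

  listed : ∀ F → Family F → F ⊑ G → Listed
  listed F F∈ f = F , F∈ , obs⇒≅ (C n) G∈obs f (proj₁ (listed⇒obs n 5≤n F∈))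

  excluded : ∀ F → F ⊑ G → order F < order G → ¬ ¬ FullColouring (C n) F
  excluded F f F<G ¬col = ¬col (proper-colour (C n) G∈obs f F<G)

  -- For `n` below the bound in `O`, a proper subgraph of `A` would already be noncolourable,
  -- against minimality. `B` and `E` are treated alike.
  A-listed : A ⊑ G → Listed
  A-listed f = listed A (inj₂ (inj₂ (A∈O (ℕ.≤-pred (ℕ.≮⇒≥ λ n<7 →
    excluded (LF₂-graph 0 1) (⊑-trans K₁+P₄⊑A f) (⊑⇒≤ f) (LF₂-noncolourable 3≤n 0 1 n<7)))))) f

  B-listed : B ⊑ G → Listed
  B-listed f = listed B (inj₂ (inj₂ (B∈O (ℕ.≤-pred (ℕ.≮⇒≥ λ n<6 →
    excluded (P 5) (⊑-trans P₅⊑B f) (⊑⇒≤ f)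
      (thick-noncolourable {G = P 5} (P-pointDetermining λ ()) (P-thick 3≤n 4) n<6)))))) f

  E-listed : E ⊑ G → Listed
  E-listed f = listed E (inj₂ (inj₂ (E∈O (ℕ.≤-pred (ℕ.≮⇒≥ λ n<8 →
    excluded (LF₂-graph 2 0) (⊑-trans K₁+2K₂⊑E f) (⊑⇒≤ f) (LF₂-noncolourable 3≤n 2 0 n<8)))))) f

  distinguish : ∀ {x y} → x ≢ y → ∃ (Distinguishes G x y)
  distinguish = obs-distinguishes (C n) G G∈obs

  triangle-listed : ∀ {x y z} → x ~ y → y ~ z → x ~ z → Listed
  triangle-listed {x} {y} {z} xy yz xz = listed (C 3) (inj₁ triangle)
    (agree⇒⊑ (C 3) G (lookup (x ∷ y ∷ z ∷ [])) (C-pointDetermining ℕ.≤-refl λ ())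
      λ { 1F 0F → xy ; 2F 0F → xz ; 2F 1F → yz })

  -- Squares and vertices of degree three.

  module _ (no-△ : ∀ {x y z} → x ~ y → y ~ z → x ~ z → ⊥) where

    -- Absence of triangles settles every adjacency that is not given, except `x ~ y`, which decides
    -- between `A` and `B`.
    pendants-listed : ∀ {a b c d x y} → a ~ b → b ~ c → c ~ d → d ~ a →
                      x ~ a → ¬ x ~ c → y ~ b → ¬ y ~ d → Listed
    pendants-listed {a} {b} {c} {d} {x} {y} ab bc cd da xa ¬xc yb ¬yd = split (x ~? y)
      where
      f = lookup (x ∷ a ∷ d ∷ c ∷ b ∷ y ∷ [])

      split : Dec (x ~ y) → Listed
      split (no ¬xy) = A-listed (agree⇒⊑ A G f A-pointDetermining λ where
        1F 0F → xa
        2F 0F → no-△ xa (symm da)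
        2F 1F → symm da
        3F 0F → ¬xc
        3F 1F → no-△ ab bc
        3F 2F → symm cd
        4F 0F → no-△ xa ab
        4F 1F → ab
        4F 2F → no-△ da ab
        4F 3F → symm bc
        5F 0F → ¬xy
        5F 1F → no-△ ab (symm yb)
        5F 2F → ¬yd ∘ symm
        5F 3F → no-△ (symm bc) (symm yb)
        5F 4F → symm yb)
      split (yes xy) = B-listed (agree⇒⊑ B G f B-pointDetermining λ where
        1F 0F → xa
        2F 0F → no-△ xa (symm da)
        2F 1F → symm da
        3F 0F → ¬xc
        3F 1F → no-△ ab bc
        3F 2F → symm cd
        4F 0F → no-△ xa ab
        4F 1F → ab
        4F 2F → no-△ da ab
        4F 3F → symm bc
        5F 0F → xy
        5F 1F → no-△ ab (symm yb)
        5F 2F → ¬yd ∘ symm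
        5F 3F → no-△ (symm bc) (symm yb)
        5F 4F → symm yb)

    -- Opposite corners are not twins, so one corner of each diagonal has a neighbour that the other
    -- lacks. Two such corners are adjacent, and the symmetries of the square do the rest.
    square-listed : ∀ {a b c d} → a ~ b → b ~ c → c ~ d → d ~ a → a ≢ c → b ≢ d → Listed
    square-listed {a} {b} {c} {d} ab bc cd da a≢c b≢d = split (distinguish a≢c) (distinguish b≢d)
      where
      split : ∃ (Distinguishes G a c) → ∃ (Distinguishes G b d) → Listed
      split (x , inj₁ (xa , ¬xc)) (y , inj₁ (yb , ¬yd)) = pendants-listed ab bc cd da xa ¬xc yb ¬yd
      split (x , inj₁ (xa , ¬xc)) (y , inj₂ (¬yb , yd)) =
        pendants-listed (symm da) (symm cd) (symm bc) (symm ab) xa ¬xc yd ¬yb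
      split (x , inj₂ (¬xa , xc)) (y , inj₁ (yb , ¬yd)) =
        pendants-listed (symm bc) (symm ab) (symm da) (symm cd) xc ¬xa yb ¬yd
      split (x , inj₂ (¬xa , xc)) (y , inj₂ (¬yb , yd)) = pendants-listed cd da ab bc xc ¬xa yd ¬yb

    module _ (no-□ : ∀ {a b c d} → a ~ b → b ~ c → c ~ d → d ~ a → a ≢ c → b ≢ d → ⊥) where

      spider-listed : ∀ {c a b d x y} → c ~ a → c ~ b → c ~ d → a ≢ b → b ≢ d → a ≢ d →
                      x ~ a → c ≢ x → y ~ b → c ≢ y → Listed
      spider-listed {c} {a} {b} {d} {x} {y} ca cb cd a≢b b≢d a≢d xa c≢x yb c≢y = split (x ~? y)
        where
        ¬ab = no-△ (symm ca) cb
        ¬ad = no-△ (symm ca) cd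
        ¬bd = no-△ (symm cb) cd
        ¬cx = no-△ ca (symm xa)
        ¬cy = no-△ cb (symm yb)

        ¬xb : ¬ x ~ b
        ¬xb xb = no-□ ca (symm xa) xb (symm cb) c≢x a≢b
        ¬xd : ¬ x ~ d
        ¬xd xd = no-□ ca (symm xa) xd (symm cd) c≢x a≢d
        ¬ya : ¬ y ~ a
        ¬ya ya = no-□ cb (symm yb) ya (symm ca) c≢y (a≢b ∘ sym)
        ¬yd : ¬ y ~ d
        ¬yd yd = no-□ cb (symm yb) yd (symm cd) c≢y b≢d

        pentagon : x ~ y → C 5 ⊑ G
        pentagon xy = agree⇒⊑ (C 5) G (lookup (c ∷ a ∷ x ∷ y ∷ b ∷ []))
          (C-pointDetermining (s≤s (s≤s (s≤s z≤n))) λ ()) λ where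
            1F 0F → ca
            2F 0F → ¬cx
            2F 1F → symm xa
            3F 0F → ¬cy
            3F 1F → ¬ya ∘ symm
            3F 2F → xy
            4F 0F → cb
            4F 1F → ¬ab
            4F 2F → ¬xb
            4F 3F → yb

        K₁+P₄ : x ~ y → LF₂-graph 0 1 ⊑ G
        K₁+P₄ xy = agree⇒⊑ (LF₂-graph 0 1) G (lookup (d ∷ a ∷ x ∷ y ∷ b ∷ []))
          (distinguished⇒pointDetermining (LF₂-graph 0 1) (from-yes (isPointDetermining? (LF₂-graph 0 1)))) λ where
            1F 0F → ¬ad ∘ symm
            2F 0F → ¬xd ∘ symm
            2F 1F → symm xa
            3F 0F → ¬yd ∘ symm
            3F 1F → ¬ya ∘ symm
            3F 2F → xy
            4F 0F → ¬bd ∘ symm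
            4F 1F → ¬ab
            4F 2F → ¬xb
            4F 3F → yb

        split : Dec (x ~ y) → Listed
        split (yes xy) with ℕ.m≤n⇒m<n∨m≡n 5≤n
        ... | inj₁ 5<n  = listed (C 5) (inj₁ (cycle 5 ℕ.≤-refl (subst (5 ≤_) (ℕ.+-comm 1 k) (ℕ.≤-pred 5<n)))) (pentagon xy)
        -- For `n = 5` the pentagon is `C n` itself. Instead, `d` and the path a, x, y, b form a
        -- graph of weight 7, which belongs to `LF₂`.
        ... | inj₂ refl = listed (LF₂-graph 0 1) (inj₂ (inj₁ (inj₂ (inj₁ (lf₂ 0 1 refl))))) (K₁+P₄ xy)
        split (no ¬xy) = E-listed (agree⇒⊑ E G (lookup (a ∷ c ∷ b ∷ y ∷ d ∷ x ∷ [])) E-pointDetermining λ where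
          1F 0F → symm ca
          2F 0F → ¬ab
          2F 1F → cb
          3F 0F → ¬ya ∘ symm
          3F 1F → ¬cy
          3F 2F → symm yb
          4F 0F → ¬ad
          4F 1F → cd
          4F 2F → ¬bd
          4F 3F → ¬yd
          5F 0F → symm xa
          5F 1F → ¬cx
          5F 2F → ¬xb ∘ symm
          5F 3F → ¬xy ∘ symm
          5F 4F → ¬xd ∘ symm)

      -- Separating two leaves gives one of them a further neighbour; separating the other two gives
      -- the same for a second leaf. Both new vertices differ from `c`, which is adjacent to all
      -- leaves.
      claw-listed : ∀ {c a b d} → c ~ a → c ~ b → c ~ d → a ≢ b → b ≢ d → a ≢ d → Listed
      claw-listed {c} {a} {b} {d} ca cb cd a≢b b≢d a≢d = split (distinguish a≢b)
        where
        off : ∀ {x y} → ¬ x ~ y → c ~ y → c ≢ x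
        off ¬xy cy refl = ¬xy cy

        split : ∃ (Distinguishes G a b) → Listed
        split (x , inj₁ (xa , ¬xb)) with distinguish b≢d
        ... | y , inj₁ (yb , ¬yd) = spider-listed ca cb cd a≢b b≢d a≢d xa (off ¬xb cb) yb (off ¬yd cd)
        ... | y , inj₂ (¬yb , yd) = spider-listed ca cd cb a≢d (b≢d ∘ sym) a≢b xa (off ¬xb cb) yd (off ¬yb cb)
        split (x , inj₂ (¬xa , xb)) with distinguish a≢d
        ... | y , inj₁ (ya , ¬yd) = spider-listed cb ca cd (a≢b ∘ sym) a≢d b≢d xb (off ¬xa ca) ya (off ¬yd cd)
        ... | y , inj₂ (¬ya , yd) = spider-listed cb cd ca b≢d (a≢d ∘ sym) (a≢b ∘ sym) xb (off ¬xa ca) yd (off ¬ya ca)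

      -- Obstructions of maximum degree two.

      module _ (deg : MaxDegree≤2 G) where

        open Walks G deg

        P-noncolourable : ¬ FullColouring (C n) (P n)
        P-noncolourable = thick-noncolourable {G = P n}
          (P-pointDetermining λ { refl → contradiction 5≤n λ { (s≤s (s≤s (s≤s ()))) } }) (P-thick 3≤n (suc k)) ℕ.≤-refl

        K₁+P-noncolourable : ¬ FullColouring (C n) (K 1 ⊕ P (suc k))
        K₁+P-noncolourable = thick-noncolourable {G = K 1 ⊕ P (suc k)}
          (⊕-pointDetermining (K 1) (P (suc k)) K₁-pointDetermining (P-pointDetermining ≢3) (noIsolated (ℕ.≤-pred 5≤n)))
          (⊕-thick {F = K 1} {P (suc k)} 2≤n (K₁-thick 3≤n) (P-thick 3≤n k)) (ℕ.m≤n⇒m≤1+n ℕ.≤-refl)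
          where
          ≢3 : suc k ≢ 3
          ≢3 refl = contradiction 5≤n λ { (s≤s (s≤s (s≤s (s≤s ())))) }

          noIsolated : ∀ {l} → 4 ≤ l → HasNoIsolated (P l)
          noIsolated {suc (suc l)} _ = P-hasNoIsolated l
          noIsolated {suc zero} (s≤s ())

        -- Here G properly contains the noncolourable K₁ + P_{n-1}, unless it is C n itself.
        no-n-cycle : ∀ {S l p} (π : Path G S l p) (2≤l : 2 ≤ l) (closing : p 0 ~ p l) → suc l ≡ n → ⊥
        no-n-cycle {l = l} π 2≤l closing refl = [ whole , (λ (v , v∉) → partial v v∉) ]′ (surjective? (to (rel f)))
          where
          f : C n ⊑ G
          f = cycle-⊑ π 2≤l closing

          whole : ¬ Surjective (to (rel f))
          whole sur = proj₁ G∈obs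
            (colour-⊑ (C n) (≅⇒⊑ G (C n) (⊑-surjective⇒≅ f sur)) (id , λ _ _ → ⇔.refl))

          partial : ∀ v → ¬ (∀ x → to (rel f) x ≢ v)
          partial v v∉f = excluded (K 1 ⊕ P (suc k))
            (⊕-universal point path (λ _ y eq → v∉f _ (sym eq)) λ _ y r →
              [ (λ eq → v∉f _ (sym eq)) , (λ eq → v∉f _ (sym eq)) ]′ (around-closed π 2≤l closing _ (symm r)))
            (missed⇒< (injective (rel f)) v v∉f) K₁+P-noncolourable
            where
            point : K 1 ⊑ G
            point = hom⇒⊑ (K 1) G {λ _ → v} K₁-pointDetermining
              λ { 0F 0F → mk⇔ (λ (0≢0 , _) → contradiction refl 0≢0) (λ r → contradiction r (irrefl refl)) }

            path : P (suc k) ⊑ G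
            path = ⊑-trans (P-⊑-C ℕ.≤-refl) f

        cyclic-listed : ∀ {S l p} → Path G S l p → 2 ≤ l → p 0 ~ p l → Listed
        cyclic-listed {l = l} {p} π 2≤l closing = split (ℕ.<-cmp (suc l) n)
          where
          f : C (suc l) ⊑ G
          f = cycle-⊑ π 2≤l closing

          open Path π

          short : ∀ l → C (suc l) ⊑ G → 2 ≤ l → l ≢ 3 → suc l < n → Listed
          short 0 _ () _ _
          short 1 _ (s≤s ()) _ _
          short 2 f _ _ _ = listed (C 3) (inj₁ triangle) f
          short 3 _ _ 3≢3 _ = contradiction refl 3≢3
          short (suc (suc (suc (suc l)))) f _ _ lt = listed (C (5 + l))
            (inj₁ (cycle (5 + l) (s≤s (s≤s (s≤s (s≤s (s≤s z≤n)))))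
              (subst (5 + l ≤_) (ℕ.+-comm 1 k) (ℕ.≤-pred lt)))) f

          split : _ → Listed
          split (tri< lt _ _) = short l f 2≤l (λ { refl →
            no-□ (edge (s≤s z≤n)) (edge (s≤s (s≤s z≤n))) (edge (s≤s (s≤s (s≤s z≤n)))) (symm closing)
              (λ eq → contradiction (distinct z≤n (s≤s (s≤s z≤n)) eq) λ ())
              (λ eq → contradiction (distinct (s≤s z≤n) ℕ.≤-refl eq) λ ()) }) lt
          split (tri≈ _ eq _) = ⊥-elim (no-n-cycle π 2≤l closing eq)
          split (tri> _ _ gt) = ⊥-elim (excluded (P n) (⊑-trans (P-⊑-C gt) f)
            (ℕ.<-≤-trans gt (⊑⇒≤ f)) P-noncolourable)

        -- A union of components of `G`, identified with a linear forest. By `closed` no edge leaves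
        -- it, so a path component found outside can be added as a disjoint summand.
        record Components (L : List ℕ) : Set where
          field
            positive  : All (1 ≤_) L
            embedding : forest L ⊑ G
            closed    : ∀ x {y} → to (rel embedding) x ~ y → ∃[ z ] to (rel embedding) z ≡ y

        no-components : Components []
        no-components = record
          { positive = [] ; embedding = emb (record { to = λ () ; injective = λ { {()} } ; full = λ () }) ; closed = λ () }

        add-component : ∀ {L l p} (cs : Components L) → let open Components cs in
          (π : Path G (λ y → ∀ x → to (rel embedding) x ≢ y) l p) →
          HeadEnd G p → (∀ {y z} → p l ~ y → p l ~ z → y ≡ z) → Components (suc l ∷ L)
        add-component {L} {l} {p} cs π head-end tail-end = record
          { positive  = s≤s z≤n ∷ positive
          ; embedding = ⊕-universal g embedding
              (λ x y eq → inside (toℕ x) y (sym eq))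
              (λ x y r → let z , eq = closed y (symm r) in inside (toℕ x) z eq)
          ; closed    = λ x → closed′ (splitAt (suc l) x)
          }
          where
          open Components cs
          open Path π

          g : P (suc l) ⊑ G
          g = path-⊑ π head-end tail-end

          h : Fin (suc l) ⊎ Vertex (forest L) → Vertex G
          h = [ to (rel g) , to (rel embedding) ]′

          closed′ : ∀ s {y} → h s ~ y → ∃[ z ] h (splitAt (suc l) z) ≡ y
          closed′ (inj₁ x) r = let z , eq = path-closed π head-end tail-end x r in
            join (suc l) (order (forest L)) (inj₁ z) ,
            trans (cong h (Fin.splitAt-join (suc l) (order (forest L)) (inj₁ z))) eq
          closed′ (inj₂ x) r = let z , eq = closed x r in
            join (suc l) (order (forest L)) (inj₂ z) ,
            trans (cong h (Fin.splitAt-join (suc l) (order (forest L)) (inj₂ z))) eq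

        -- Each round adds a component and so at least one vertex; `fuel` bounds the number of
        -- vertices not yet covered.
        decompose : ∀ fuel L → order G ≤ fuel + order (forest L) → Components L → Listed
        decompose fuel L enough cs =
          [ finish , (λ (v , v∉) → extend fuel enough v v∉) ]′ (surjective? (to (rel embedding)))
          where
          open Components cs

          finish : Surjective (to (rel embedding)) → Listed
          finish sur = let F , F∈LF , f = obs-forest 3≤n L positive forest∈obs in
            listed F (inj₂ (inj₁ F∈LF)) (⊑-trans f embedding)
            where
            forest∈obs : obs (C n) (forest L)
            forest∈obs = obs-≅ (C n) G (forest L) (≅-sym G (forest L) (⊑-surjective⇒≅ embedding sur)) G∈obs

          Outside : Pred (Vertex G) 0ℓ
          Outside y = ∀ x → to (rel embedding) x ≢ y

          outside-closed : ∀ {x y} → Outside x → x ~ y → Outside y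
          outside-closed x∉ r z refl = let w , eq = closed z (symm r) in x∉ w eq

          extend : ∀ fuel → order G ≤ fuel + order (forest L) → ∀ v → Outside v → Listed
          extend zero       enough v v∉ = contradiction (missed⇒< (injective (rel embedding)) v v∉) (ℕ.≤⇒≯ enough)
          extend (suc fuel) enough v v∉ = [ cyclic , second ]′ (walk v∉)
            where
            walk : ∀ {v} → Outside v → Cyclic Outside outside-closed ⊎ Grown Outside outside-closed v
            walk v∉ = grow Outside outside-closed (order G) (ℕ.m≤m+n (order G) 1) (trivial-path Outside outside-closed v∉)

            cyclic : Cyclic Outside outside-closed → Listed
            cyclic (l , p , π , 2≤l , closing) = cyclic-listed π 2≤l closing

            third : ∀ {e} → (∀ {y z} → e ~ y → e ~ z → y ≡ z) → Grown Outside outside-closed e → Listed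
            third e-end (l , p , π , head-end , refl) = decompose fuel (suc l ∷ L)
              (ℕ.≤-trans enough (ℕ.≤-trans (ℕ.≤-reflexive (sym (ℕ.+-suc fuel (order (forest L)))))
                (ℕ.+-monoʳ-≤ fuel (s≤s (ℕ.m≤n+m _ l)))))
              (add-component cs π head-end e-end)

            -- Walking back from the end reached by the first walk traverses the
            -- whole component.
            second : Grown Outside outside-closed v → Listed
            second (l , p , π , head-end , _) =
              [ cyclic , third (λ r s → trans (head-end _ r) (sym (head-end _ s))) ]′ (walk (Path.inside π 0))

        max-degree-2-listed : Listed
        max-degree-2-listed = decompose (order G) [] (ℕ.m≤m+n (order G) 0) no-components

  listed-by-cases : Listed
  listed-by-cases = case-△ (Fin.any? λ x → Fin.any? λ y → Fin.any? λ z → (x ~? y) ×-dec (y ~? z) ×-dec (x ~? z))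
    where
    case-△ : Dec (∃[ x ] ∃[ y ] ∃[ z ] x ~ y × y ~ z × x ~ z) → Listed
    case-△ (yes (x , y , z , xy , yz , xz)) = triangle-listed xy yz xz
    case-△ (no ¬△) = case-□ (Fin.any? λ a → Fin.any? λ b → Fin.any? λ c → Fin.any? λ d →
        (a ~? b) ×-dec (b ~? c) ×-dec (c ~? d) ×-dec (d ~? a) ×-dec ¬? (a Fin.≟ c) ×-dec ¬? (b Fin.≟ d))
      where
      no-△ : ∀ {x y z} → x ~ y → y ~ z → x ~ z → ⊥
      no-△ xy yz xz = ¬△ (_ , _ , _ , xy , yz , xz)

      case-□ : Dec (∃[ a ] ∃[ b ] ∃[ c ] ∃[ d ] a ~ b × b ~ c × c ~ d × d ~ a × a ≢ c × b ≢ d) → Listed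
      case-□ (yes (a , b , c , d , ab , bc , cd , da , a≢c , b≢d)) = square-listed no-△ ab bc cd da a≢c b≢d
      case-□ (no ¬□) = case-claw (Fin.any? λ c → Fin.any? λ x → Fin.any? λ y → Fin.any? λ z →
          (c ~? x) ×-dec (c ~? y) ×-dec (c ~? z) ×-dec ¬? (x Fin.≟ y) ×-dec ¬? (y Fin.≟ z) ×-dec ¬? (x Fin.≟ z))
        where
        no-□ : ∀ {a b c d} → a ~ b → b ~ c → c ~ d → d ~ a → a ≢ c → b ≢ d → ⊥
        no-□ ab bc cd da a≢c b≢d = ¬□ (_ , _ , _ , _ , ab , bc , cd , da , a≢c , b≢d)

        case-claw : Dec (∃[ c ] ∃[ x ] ∃[ y ] ∃[ z ] c ~ x × c ~ y × c ~ z × x ≢ y × y ≢ z × x ≢ z) → Listed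
        case-claw (yes (_ , _ , _ , _ , cx , cy , cz , x≢y , y≢z , x≢z)) =
          claw-listed no-△ no-□ cx cy cz x≢y y≢z x≢z
        case-claw (no ¬claw) = max-degree-2-listed no-△ no-□
          λ cx cy cz x≢y y≢z x≢z → ¬claw (_ , _ , _ , _ , cx , cy , cz , x≢y , y≢z , x≢z)

theorem3p10 : (n : ℕ) → 5 ≤ n →
    obs (C n) ≐ UpToIso (CycleFamily (n ∸ 2) ∪ LF (n ∸ 1) ∪ O (n ∸ 1))
theorem3p10 (suc zero) (s≤s ())
theorem3p10 n@(suc (suc k)) 5≤n =
  (λ {G} → Obstruction.listed-by-cases k 5≤n G) ,
  (λ {G} (F , F∈ , G≅F) → obs-≅ (C n) F G G≅F (listed⇒obs n 5≤n F∈))
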